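{- Let $n,k$ be positive integers with $k\le 2\cdot 3^n$. Then: if $n\ge 2$, $v_3(s(2\cdot3^n,k))\le v_3(s(2\cdot3^n,1))=3^n-n-1$; if $n=1$, $v_3(s(2\cdot 3,k))\le v_3(s(2\cdot3,3))=2$.
   Context: $s(N,K)$ denotes the unsigned Stirling number of the first kind (the number of permutations of $N$ elements with exactly $K$ disjoint cycles). For a nonzero integer $x$, $v_3(x)$ is the exponent of the largest power of $3$ dividing $x$. -}

module Defs where

open import Data.Nat using (ℕ; zero; suc; _+_; _*_; _%_; _/_)

stirling1 : ℕ → ℕ → ℕ
stirling1 zero    zero    = 1
stirling1 zero    (suc k) = 0
stirling1 (suc n) zero    = 0
stirling1 (suc n) (suc k) = n * stirling1 n (suc k) + stirling1 n k

v3-aux : ℕ → ℕ → ℕ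
v3-aux zero       x = 0
v3-aux (suc fuel) zero = 0
v3-aux (suc fuel) (suc x) with (suc x) % 3
... | zero  = suc (v3-aux fuel (suc x / 3))
... | suc _ = 0

-- v3 x = exponent of the largest power of 3 dividing x (for x ≠ 0;
-- fuel x suffices since 3^v ≤ x).  Convention v3 0 = 0 (never used).
v3 : ℕ → ℕ
v3 x = v3-aux x x

{-# OPTIONS --safe #-}

-- Put Q = 3ⁿ and y = x + Q. Then x(x+1)⋯(x+2Q−1)/x = y ∏_{0<j<Q} (y² − j²), so the numbers s(2Q, k)
-- are combinations of the coefficients of p_n(z) = ∏_{j<Q} (z − j²), weighted by binomial coefficients
-- and powers of Q. Splitting the j according to their residue mod 3 gives, with X = 3^m,
--   p_{m+1}(z) = 9^X p_m(z/9) U(z),   U(z) ≡ (z − 1)^{2X} mod 3^{m+1},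
-- where the congruence follows by repeated cubing. As v(C(2X, e)) = m − v(e) for 0 < e ≤ 2X, exactly one
-- term of each convolution sum has least valuation, which yields the exact valuation w m i of the i-th
-- coefficient of p_m. The same dominance argument gives v(s(2Q, 2t+1)) = w n (t+1) + n + v(2t+1) and
-- v(s(2Q, 2t+2)) = w n (t+1), and the bound becomes an inequality for w.
module Submission where

open import Defs
open import Data.Nat
open import Data.Nat.Properties
open import Data.Nat.DivMod using (m*n/n≡m)
import Data.Nat.Divisibility as ℕ∣
open import Data.Nat.Primality using (Prime; prime?; euclidsLemma)
import Data.Nat.Tactic.RingSolver as ℕSolver
open import Data.Integer using (ℤ; +_)
  renaming (∣_∣ to abs; _+_ to _⊕_; _*_ to _⊗_; _-_ to _⊖_; -_ to ⊝_; _^_ to _⊗^_)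
import Data.Integer.Properties as ℤ
open import Data.Integer.Divisibility.Signed
  using (_∣_; divides; ∣ᵤ⇒∣; ∣⇒∣ᵤ; ∣-trans; ∣-refl; ∣m∣n⇒∣m+n; ∣m∣n⇒∣m-n; ∣n⇒∣m*n; ∣m⇒∣m*n; *-cancelˡ-∣)
import Data.Integer.Tactic.RingSolver as ℤSolver
open import Data.List using (List; []; _∷_; _++_; map; length; replicate)
open import Data.List.Properties using (length-++; length-map; length-replicate)
open import Data.List.Relation.Binary.Permutation.Propositional
  using (_↭_; prep; swap; ↭-refl; ↭-sym; ↭-trans)
open import Data.List.Relation.Binary.Permutation.Propositional.Properties using (++-comm; shift; ++⁺ˡ)
open import Data.Product using (_×_; _,_; ∃; proj₁; proj₂)
open import Data.Sum using (_⊎_; inj₁; inj₂; [_,_]′)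
open import Data.Empty using (⊥-elim)
open import Function using (_∘_)
open import Relation.Nullary using (¬_; yes; no)
open import Relation.Nullary.Decidable using (toWitness; from-no)
open import Relation.Binary.PropositionalEquality
  using (_≡_; _≢_; _≗_; refl; sym; trans; cong; cong₂; subst; subst₂; module ≡-Reasoning)

-- 3-adic valuations

-- An upper bound on a valuation does not survive addition, so the maximum is reached only through
-- exact valuations, hence through a unique dominant term in every sum. Put X = 3^m. For i ≤ X the
-- dominant term of the convolution pairs coefficient i of 9^X p_m(z/9) with the constant term of U,
-- a unit; a lower coefficient pays a factor 9 per step, which outweighs all that can be saved
-- elsewhere (`w-growth`). For i > X it pairs the leading coefficient 1 with a coefficient of U;
-- lower ones pay powers of 9 again, and when the coefficient of U gets less divisible, `w-codegree`
-- closes the gap. These two regimes are the two branches of `w`. The modulus 3^(m+1) is just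
-- precise enough, because the binomial coefficients involved have valuation at most m. For s(2Q,
-- k), centring at -Q leaves only odd powers of y, so consecutive terms differ by Q², worth 2n,
-- while `w` drops by at most 2n - 2 per step (`w-step`).

-- Linear arithmetic by certificate: the hypotheses are added up to a ≤ b, s is the slack, and the
-- remaining identity is left to the ring solver.
lin≤ : ∀ {a b} c d s → a ≤ b → c + b + s ≡ d + a → c ≤ d
lin≤ {a} {b} c d s a≤b eq = +-cancelʳ-≤ a c d (begin
  c + a      ≤⟨ +-monoʳ-≤ c a≤b ⟩
  c + b      ≤⟨ m≤m+n (c + b) s ⟩
  c + b + s  ≡⟨ eq ⟩
  d + a      ∎)
  where open ≤-Reasoning

prime-3 : Prime 3
prime-3 = toWitness {a? = prime? 3} _

-- Exact valuation as a factorisation, which applies to signed integers and excludes 0 by itself;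
-- `Val⇒v3` translates back to `v3` at the end.
record Val (w : ℕ) (x : ℤ) : Set where
  constructor val
  field
    unit   : ℤ
    factor : x ≡ + (3 ^ w) ⊗ unit
    3∤unit : ¬ (+ 3 ∣ unit)

3^-+ : ∀ a b → + (3 ^ (a + b)) ≡ + (3 ^ a) ⊗ + (3 ^ b)
3^-+ a b = trans (cong +_ (^-distribˡ-+-* 3 a b)) (ℤ.pos-* (3 ^ a) (3 ^ b))

3^-∣ : ∀ {a b} → a ≤ b → + (3 ^ a) ∣ + (3 ^ b)
3^-∣ {a} {b} a≤b = divides (+ (3 ^ (b ∸ a)))
  (trans (cong (λ z → + (3 ^ z)) (sym (m∸n+n≡m a≤b))) (3^-+ (b ∸ a) a))

*-pres-∣ : ∀ {a b x y} → a ∣ x → b ∣ y → a ⊗ b ∣ x ⊗ y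
*-pres-∣ {a} {b} {x} {y} (divides q refl) (divides r refl) = divides (q ⊗ r) (lemma q a r b)
  where
  lemma : ∀ q a r b → (q ⊗ a) ⊗ (r ⊗ b) ≡ (q ⊗ r) ⊗ (a ⊗ b)
  lemma = ℤSolver.solve-∀

3^-∣-* : ∀ {a b x y} → + (3 ^ a) ∣ x → + (3 ^ b) ∣ y → + (3 ^ (a + b)) ∣ x ⊗ y
3^-∣-* {a} {b} {x} {y} p q = subst (_∣ x ⊗ y) (sym (3^-+ a b)) (*-pres-∣ p q)

3∣-euclid : ∀ x y → + 3 ∣ x ⊗ y → + 3 ∣ x ⊎ + 3 ∣ y
3∣-euclid x y d with euclidsLemma (abs x) (abs y) prime-3 (subst (3 ℕ∣.∣_) (ℤ.abs-* x y) (∣⇒∣ᵤ d))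
... | inj₁ p = inj₁ (∣ᵤ⇒∣ p)
... | inj₂ p = inj₂ (∣ᵤ⇒∣ p)

Val⇒∣ : ∀ {w x} → Val w x → + (3 ^ w) ∣ x
Val⇒∣ {w} (val u refl _) = divides u (ℤ.*-comm (+ (3 ^ w)) u)

Val-* : ∀ {v w x y} → Val v x → Val w y → Val (v + w) (x ⊗ y)
Val-* {v} {w} (val s refl 3∤s) (val t refl 3∤t) = val (s ⊗ t)
  (trans (lemma (+ (3 ^ v)) s (+ (3 ^ w)) t) (cong (_⊗ (s ⊗ t)) (sym (3^-+ v w))))
  (λ d → [ 3∤s , 3∤t ]′ (3∣-euclid s t d))
  where
  lemma : ∀ a s b t → (a ⊗ s) ⊗ (b ⊗ t) ≡ (a ⊗ b) ⊗ (s ⊗ t)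
  lemma = ℤSolver.solve-∀

-- The ultrametric principle: the perturbation changes the unit by a multiple of 3 only.
Val-dominant : ∀ {w x y} → Val w x → + (3 ^ suc w) ∣ y ⊖ x → Val w y
Val-dominant {w} {x} {y} (val u refl 3∤u) (divides q eq) = val (u ⊕ q ⊗ + 3)
  (trans (split y ((+ (3 ^ w)) ⊗ u)) (trans (cong (_⊕ (+ (3 ^ w) ⊗ u)) eq)
      (trans (cong (λ z → q ⊗ z ⊕ + (3 ^ w) ⊗ u) (3^-+ 1 w)) (lemma (+ (3 ^ w)) u q))))
  (λ d → 3∤u (subst (+ 3 ∣_) (cancel u (q ⊗ + 3)) (∣m∣n⇒∣m-n d (∣n⇒∣m*n q ∣-refl))))
  where
  split : ∀ y x → y ≡ (y ⊖ x) ⊕ x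
  split y x = sym (trans (ℤ.+-assoc y (⊝ x) x) (trans (cong (y ⊕_) (ℤ.+-inverseˡ x)) (ℤ.+-identityʳ y)))
  lemma : ∀ p u q → q ⊗ (+ 3 ⊗ p) ⊕ p ⊗ u ≡ p ⊗ (u ⊕ q ⊗ + 3)
  lemma = ℤSolver.solve-∀
  cancel : ∀ u z → (u ⊕ z) ⊖ z ≡ u
  cancel u z = trans (ℤ.+-assoc u z (⊝ z)) (trans (cong (u ⊕_) (ℤ.+-inverseʳ z)) (ℤ.+-identityʳ u))

v3-aux-3^* : ∀ fuel w u x → x ≡ 3 ^ w * u → ¬ (3 ℕ∣.∣ u) → w ≤ fuel → v3-aux fuel x ≡ w
v3-aux-3^* zero zero u x eq 3∤u w≤ = refl
v3-aux-3^* (suc fuel) w u zero eq 3∤u w≤ with m*n≡0⇒m≡0∨n≡0 (3 ^ w) (sym eq)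
... | inj₁ p = ⊥-elim (<⇒≢ (m^n>0 3 w) (sym p))
... | inj₂ p = ⊥-elim (3∤u (subst (3 ℕ∣.∣_) (sym p) (3 ℕ∣.∣0)))
v3-aux-3^* (suc fuel) w u (suc x) eq 3∤u w≤ with suc x % 3 in r
v3-aux-3^* (suc fuel) zero u (suc x) eq 3∤u w≤ | zero =
  ⊥-elim (3∤u (subst (3 ℕ∣.∣_) (trans eq (+-identityʳ u)) (ℕ∣.m%n≡0⇒n∣m (suc x) 3 r)))
v3-aux-3^* (suc fuel) (suc w) u (suc x) eq 3∤u (s≤s w≤) | zero =
  cong suc (v3-aux-3^* fuel w u (suc x / 3) quot 3∤u w≤)
  where
  lemma : ∀ p u → 3 * p * u ≡ (p * u) * 3
  lemma = ℕSolver.solve-∀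
  quot : suc x / 3 ≡ 3 ^ w * u
  quot = trans (cong (_/ 3) (trans eq (lemma (3 ^ w) u))) (m*n/n≡m (3 ^ w * u) 3)
v3-aux-3^* (suc fuel) zero u (suc x) eq 3∤u w≤ | suc _ = refl
v3-aux-3^* (suc fuel) (suc w) u (suc x) eq 3∤u w≤ | suc r' = ⊥-elim (0≢suc (trans (sym z) r))
  where
  0≢suc : 0 ≢ suc r'
  0≢suc ()
  lemma : ∀ p u → 3 * p * u ≡ (p * u) * 3
  lemma = ℕSolver.solve-∀
  z : suc x % 3 ≡ 0
  z = ℕ∣.n∣m⇒m%n≡0 (suc x) 3 (ℕ∣.divides (3 ^ w * u) (trans eq (lemma (3 ^ w) u)))

n<3^n : ∀ n → n < 3 ^ n
n<3^n zero    = s≤s z≤n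
n<3^n (suc n) = ≤-trans (s≤s (n<3^n n)) (lin≤ (suc (3 ^ n)) (3 ^ suc n) (3 ^ n) (m^n>0 3 n) (lemma (3 ^ n)))
  where
  lemma : ∀ p → suc p + p + p ≡ 3 * p + 1
  lemma = ℕSolver.solve-∀

Val⇒v3 : ∀ {w} x → Val w x → v3 (abs x) ≡ w
Val⇒v3 {w} x (val u eq 3∤u) = v3-aux-3^* (abs x) w (abs u) (abs x) abs-eq (λ d → 3∤u (∣ᵤ⇒∣ d)) w≤
  where
  abs-eq : abs x ≡ 3 ^ w * abs u
  abs-eq = trans (cong abs eq) (ℤ.abs-* (+ (3 ^ w)) u)
  instance
    u≢0 : NonZero (abs u)
    u≢0 = ≢-nonZero (λ z → 3∤u (∣ᵤ⇒∣ (subst (3 ℕ∣.∣_) (sym z) (3 ℕ∣.∣0))))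
  w≤ : w ≤ abs x
  w≤ = subst (w ≤_) (sym abs-eq) (≤-trans (<⇒≤ (n<3^n w)) (m≤m*n (3 ^ w) (abs u)))

∃Val : ∀ bound x → .{{NonZero x}} → x ≤ bound → ∃ λ w → Val w (+ x)
∃Val zero (suc x) ()
∃Val (suc bound) x x≤ with 3 ℕ∣.∣? x
... | no 3∤x = 0 , val (+ x) (sym (ℤ.*-identityˡ (+ x))) (λ d → 3∤x (∣⇒∣ᵤ d))
... | yes (ℕ∣.divides q@(suc q') refl) with ∃Val bound q (≤-pred (≤-trans (lin≤ (suc q) (q * 3) (suc (q' + q')) (z≤n {0}) (lemma q')) x≤))
  where
  lemma : ∀ q' → suc (suc q') + 0 + suc (q' + q') ≡ (suc q') * 3 + 0
  lemma = ℕSolver.solve-∀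
... | w , val u eq 3∤u = suc w , val u (trans (ℤ.pos-* q 3) (trans (cong (_⊗ + 3) eq)
        (trans (lemma (+ (3 ^ w)) u) (cong (_⊗ u) (sym (3^-+ 1 w)))))) 3∤u
  where
  lemma : ∀ p u → (p ⊗ u) ⊗ + 3 ≡ (+ 3 ⊗ p) ⊗ u
  lemma = ℤSolver.solve-∀

v3-Val : ∀ x → .{{NonZero x}} → Val (v3 x) (+ x)
v3-Val x with ∃Val x x ≤-refl
... | w , p = subst (λ z → Val z (+ x)) (sym (Val⇒v3 (+ x) p)) p

Val-1 : Val 0 (+ 1)
Val-1 = v3-Val 1

v3-* : ∀ x y → .{{NonZero x}} → .{{NonZero y}} → v3 (x * y) ≡ v3 x + v3 y
v3-* x y = Val⇒v3 (+ (x * y)) (subst (Val (v3 x + v3 y)) (sym (ℤ.pos-* x y)) (Val-* (v3-Val x) (v3-Val y)))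

3^v3∣ : ∀ x → 3 ^ v3 x ℕ∣.∣ x
3^v3∣ zero    = 1 ℕ∣.∣0
3^v3∣ (suc x) = ∣⇒∣ᵤ (Val⇒∣ (v3-Val (suc x)))

3^∣⇒≤v3 : ∀ k x → .{{NonZero x}} → 3 ^ k ℕ∣.∣ x → k ≤ v3 x
3^∣⇒≤v3 k x d with k ≤? v3 x | v3-Val x
... | yes k≤ | _ = k≤
... | no  k≰ | val u eq 3∤u = ⊥-elim (3∤u (*-cancelˡ-∣ (+ (3 ^ v3 x)) {{m^n≢0 3 (v3 x)}}
      (subst (_∣ + (3 ^ v3 x) ⊗ u) (trans (3^-+ 1 (v3 x)) (ℤ.*-comm (+ 3) (+ (3 ^ v3 x))))
      (subst (+ (3 ^ suc (v3 x)) ∣_) eq (∣-trans (3^-∣ (≰⇒> k≰)) (∣ᵤ⇒∣ d))))))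

<3^⇒v3< : ∀ k x → .{{NonZero x}} → x < 3 ^ k → v3 x < k
<3^⇒v3< k x x< with suc (v3 x) ≤? k
... | yes p = p
... | no ¬p = ⊥-elim (<⇒≱ x< (≤-trans (^-monoʳ-≤ 3 (≤-pred (≰⇒> ¬p))) (ℕ∣.∣⇒≤ (3^v3∣ x))))

v3≤ : ∀ x → v3 (suc x) ≤ x
v3≤ x = ≤-pred (<3^⇒v3< (suc x) (suc x) (n<3^n (suc x)))

-- Polynomials as coefficient sequences

-- Polynomials are coefficient sequences; mulLin c multiplies by z − c.
mulLin : ℤ → (ℕ → ℤ) → ℕ → ℤ
mulLin c f zero    = ⊝ (c ⊗ f 0)
mulLin c f (suc k) = f k ⊕ ⊝ (c ⊗ f (suc k))

mulLins : List ℤ → (ℕ → ℤ) → ℕ → ℤ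
mulLins []       f = f
mulLins (c ∷ cs) f = mulLin c (mulLins cs f)

one : ℕ → ℤ
one zero    = + 1
one (suc _) = + 0

mulLin-cong : ∀ c {f g} → f ≗ g → mulLin c f ≗ mulLin c g
mulLin-cong c f≗g zero    = cong (λ x → ⊝ (c ⊗ x)) (f≗g 0)
mulLin-cong c f≗g (suc k) = cong₂ (λ x y → x ⊕ ⊝ (c ⊗ y)) (f≗g k) (f≗g (suc k))

mulLins-cong : ∀ cs {f g} → f ≗ g → mulLins cs f ≗ mulLins cs g
mulLins-cong []       f≗g = f≗g
mulLins-cong (c ∷ cs) f≗g = mulLin-cong c (mulLins-cong cs f≗g)

mulLin-comm : ∀ c d f → mulLin c (mulLin d f) ≗ mulLin d (mulLin c f)
mulLin-comm c d f zero = lemma c d (f 0)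
  where
  lemma : ∀ c d x → ⊝ (c ⊗ ⊝ (d ⊗ x)) ≡ ⊝ (d ⊗ ⊝ (c ⊗ x))
  lemma = ℤSolver.solve-∀
mulLin-comm c d f (suc zero) = lemma c d (f 0) (f 1)
  where
  lemma : ∀ c d x y → ⊝ (d ⊗ x) ⊕ ⊝ (c ⊗ (x ⊕ ⊝ (d ⊗ y))) ≡ ⊝ (c ⊗ x) ⊕ ⊝ (d ⊗ (x ⊕ ⊝ (c ⊗ y)))
  lemma = ℤSolver.solve-∀
mulLin-comm c d f (suc (suc k)) = lemma c d (f k) (f (suc k)) (f (suc (suc k)))
  where
  lemma : ∀ c d x y z → x ⊕ ⊝ (d ⊗ y) ⊕ ⊝ (c ⊗ (y ⊕ ⊝ (d ⊗ z))) ≡ x ⊕ ⊝ (c ⊗ y) ⊕ ⊝ (d ⊗ (y ⊕ ⊝ (c ⊗ z)))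
  lemma = ℤSolver.solve-∀

mulLin-linear : ∀ c s f g →
  mulLin c (λ k → f k ⊕ s ⊗ g k) ≗ (λ k → mulLin c f k ⊕ s ⊗ mulLin c g k)
mulLin-linear c s f g zero = lemma c s (f 0) (g 0)
  where
  lemma : ∀ c s x y → ⊝ (c ⊗ (x ⊕ s ⊗ y)) ≡ ⊝ (c ⊗ x) ⊕ s ⊗ ⊝ (c ⊗ y)
  lemma = ℤSolver.solve-∀
mulLin-linear c s f g (suc k) = lemma c s (f k) (g k) (f (suc k)) (g (suc k))
  where
  lemma : ∀ c s x y x' y' → (x ⊕ s ⊗ y) ⊕ ⊝ (c ⊗ (x' ⊕ s ⊗ y')) ≡ (x ⊕ ⊝ (c ⊗ x')) ⊕ s ⊗ (y ⊕ ⊝ (c ⊗ y'))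
  lemma = ℤSolver.solve-∀

mulLins-linear : ∀ cs s f g →
  mulLins cs (λ k → f k ⊕ s ⊗ g k) ≗ (λ k → mulLins cs f k ⊕ s ⊗ mulLins cs g k)
mulLins-linear []       s f g k = refl
mulLins-linear (c ∷ cs) s f g k = trans (mulLin-cong c (mulLins-linear cs s f g) k)
  (mulLin-linear c s (mulLins cs f) (mulLins cs g) k)

mulLin-shift : ∀ c d f → mulLin (c ⊕ d) f ≗ (λ k → mulLin c f k ⊕ ⊝ d ⊗ f k)
mulLin-shift c d f zero = lemma c d (f 0)
  where
  lemma : ∀ c d x → ⊝ ((c ⊕ d) ⊗ x) ≡ ⊝ (c ⊗ x) ⊕ ⊝ d ⊗ x
  lemma = ℤSolver.solve-∀
mulLin-shift c d f (suc k) = lemma c d (f k) (f (suc k))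
  where
  lemma : ∀ c d x y → x ⊕ ⊝ ((c ⊕ d) ⊗ y) ≡ (x ⊕ ⊝ (c ⊗ y)) ⊕ ⊝ d ⊗ y
  lemma = ℤSolver.solve-∀

mulLins-++ : ∀ cs ds f → mulLins (cs ++ ds) f ≡ mulLins cs (mulLins ds f)
mulLins-++ []       ds f = refl
mulLins-++ (c ∷ cs) ds f = cong (mulLin c) (mulLins-++ cs ds f)

mulLins-↭ : ∀ {cs ds} → cs ↭ ds → ∀ f → mulLins cs f ≗ mulLins ds f
mulLins-↭ _↭_.refl          f k = refl
mulLins-↭ (prep c p)        f k = mulLin-cong c (mulLins-↭ p f) k
mulLins-↭ (swap {xs} c d p) f k = trans (mulLin-comm c d (mulLins xs f) k)
  (mulLin-cong d (mulLin-cong c (mulLins-↭ p f)) k)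
mulLins-↭ (_↭_.trans p q)   f k = trans (mulLins-↭ p f k) (mulLins-↭ q f k)

mulLins-comm : ∀ cs ds f → mulLins cs (mulLins ds f) ≗ mulLins ds (mulLins cs f)
mulLins-comm cs ds f k = begin
  mulLins cs (mulLins ds f) k  ≡⟨ cong (λ h → h k) (mulLins-++ cs ds f) ⟨
  mulLins (cs ++ ds) f k       ≡⟨ mulLins-↭ (++-comm cs ds) f k ⟩
  mulLins (ds ++ cs) f k       ≡⟨ cong (λ h → h k) (mulLins-++ ds cs f) ⟩
  mulLins ds (mulLins cs f) k  ∎
  where open ≡-Reasoning

mulLins-degree : ∀ cs k → length cs < k → mulLins cs one k ≡ + 0
mulLins-degree []       (suc k) l<       = refl
mulLins-degree (c ∷ cs) (suc k) (s≤s l<) = trans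
  (cong₂ (λ x y → x ⊕ ⊝ (c ⊗ y)) (mulLins-degree cs k l<) (mulLins-degree cs (suc k) (m≤n⇒m≤1+n l<)))
  (lemma c)
  where
  lemma : ∀ c → + 0 ⊕ ⊝ (c ⊗ + 0) ≡ + 0
  lemma = ℤSolver.solve-∀

-- Congruence modulo M of the monic polynomials with the given roots, as operators on sequences.
infix 4 _≈[_]_
record _≈[_]_ (cs : List ℤ) (M : ℤ) (ds : List ℤ) : Set where
  constructor congruent
  field diff : ∀ f k → ∃ λ q → mulLins cs f k ≡ mulLins ds f k ⊕ M ⊗ q
open _≈[_]_

≈-reflexive : ∀ {cs ds M} → cs ↭ ds → cs ≈[ M ] ds
≈-reflexive {M = M} p = congruent λ f k → + 0 , trans (mulLins-↭ p f k) (lemma _ M)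
  where
  lemma : ∀ x M → x ≡ x ⊕ M ⊗ + 0
  lemma = ℤSolver.solve-∀

≈-trans : ∀ {cs ds es M} → cs ≈[ M ] ds → ds ≈[ M ] es → cs ≈[ M ] es
≈-trans {es = es} {M} p q = congruent λ f k →
  let a , eq₁ = diff p f k ; b , eq₂ = diff q f k
  in a ⊕ b , trans eq₁ (trans (cong (_⊕ M ⊗ a) eq₂) (lemma (mulLins es f k) M a b))
  where
  lemma : ∀ x M a b → x ⊕ M ⊗ b ⊕ M ⊗ a ≡ x ⊕ M ⊗ (a ⊕ b)
  lemma = ℤSolver.solve-∀

-- The quotients at all k form a sequence of their own, so by linearity further factors can be
-- applied to the error term.
mulLins-diff : ∀ {cs ds M} (p : cs ≈[ M ] ds) es f k →
  mulLins es (mulLins cs f) k ≡ mulLins es (mulLins ds f) k ⊕ M ⊗ mulLins es (λ k → proj₁ (diff p f k)) k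
mulLins-diff {cs} {ds} {M} p es f k = trans (mulLins-cong es (λ k → proj₂ (diff p f k)) k)
  (mulLins-linear es M (mulLins ds f) (λ k → proj₁ (diff p f k)) k)

-- Here it pays that a congruence is demanded on every sequence f: p is used on f already multiplied
-- by the factors of `ds`.
≈-++ : ∀ {cs cs' ds ds' M} → cs ≈[ M ] cs' → ds ≈[ M ] ds' → cs ++ ds ≈[ M ] cs' ++ ds'
≈-++ {cs} {cs'} {ds} {ds'} {M} p q = congruent λ f k →
  let a , eq = diff p (mulLins ds f) k
      b      = mulLins cs' (λ k → proj₁ (diff q f k)) k
  in b ⊕ a , (begin
    mulLins (cs ++ ds) f k                             ≡⟨ cong (λ h → h k) (mulLins-++ cs ds f) ⟩
    mulLins cs (mulLins ds f) k                        ≡⟨ eq ⟩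
    mulLins cs' (mulLins ds f) k ⊕ M ⊗ a               ≡⟨ cong (_⊕ M ⊗ a) (mulLins-diff q cs' f k) ⟩
    mulLins cs' (mulLins ds' f) k ⊕ M ⊗ b ⊕ M ⊗ a      ≡⟨ lemma (mulLins cs' (mulLins ds' f) k) M a b ⟩
    mulLins cs' (mulLins ds' f) k ⊕ M ⊗ (b ⊕ a)        ≡⟨ cong (λ h → h k ⊕ M ⊗ (b ⊕ a)) (mulLins-++ cs' ds' f) ⟨
    mulLins (cs' ++ ds') f k ⊕ M ⊗ (b ⊕ a)             ∎)
  where
  open ≡-Reasoning
  lemma : ∀ x M a b → x ⊕ M ⊗ b ⊕ M ⊗ a ≡ x ⊕ M ⊗ (b ⊕ a)
  lemma = ℤSolver.solve-∀

cube : List ℤ → List ℤ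
cube cs = cs ++ cs ++ cs

-- A³ − B³ = (A − B)(A² + AB + B²), and the second factor is 3A² modulo A − B.
≈-cube : ∀ {cs ds N} → cs ≈[ + 3 ⊗ N ] ds → cube cs ≈[ + 3 ⊗ (+ 3 ⊗ N) ] cube ds
≈-cube {cs} {ds} {N} p = congruent cubes
  where
  open ≡-Reasoning
  M = + 3 ⊗ N
  A = mulLins cs
  B = mulLins ds
  cube-≡ : ∀ es f k → mulLins (cube es) f k ≡ mulLins es (mulLins es (mulLins es f)) k
  cube-≡ es f k = cong (λ h → h k) (trans (mulLins-++ es (es ++ es) f) (cong (mulLins es) (mulLins-++ es es f)))
  combine : ∀ x N u v b → x ⊕ (+ 3 ⊗ N) ⊗ b ⊕ (+ 3 ⊗ N) ⊗ v ⊕ (+ 3 ⊗ N) ⊗ u ≡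
            x ⊕ (+ 3 ⊗ N) ⊗ (b ⊕ v ⊕ u)
  combine = ℤSolver.solve-∀
  -- The three terms b add up to a multiple of 3, and the rest carries M ⊗ M = (3 ⊗ M) ⊗ N. This is
  -- why the modulus has to contain a factor 3 beforehand.
  third : ∀ x N b a c → x ⊕ (+ 3 ⊗ N) ⊗ (b ⊕ (b ⊕ (+ 3 ⊗ N) ⊗ a) ⊕ ((b ⊕ (+ 3 ⊗ N) ⊗ a) ⊕ (+ 3 ⊗ N) ⊗ c)) ≡
          x ⊕ (+ 3 ⊗ (+ 3 ⊗ N)) ⊗ (b ⊕ N ⊗ (a ⊕ a ⊕ c))
  third = ℤSolver.solve-∀
  cubes : ∀ f k → ∃ λ q → mulLins (cube cs) f k ≡ mulLins (cube ds) f k ⊕ (+ 3 ⊗ M) ⊗ q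
  cubes f k = _ , (begin
    mulLins (cube cs) f k
      ≡⟨ cube-≡ cs f k ⟩
    A (A (A f)) k
      ≡⟨ diff-at cs cs ⟩
    A (A (B f)) k ⊕ M ⊗ A (A f') k
      ≡⟨ cong (_⊕ M ⊗ A (A f') k) (mulLins-cong cs (mulLins-comm cs ds f) k) ⟩
    A (B (A f)) k ⊕ M ⊗ A (A f') k
      ≡⟨ cong (_⊕ M ⊗ A (A f') k) (diff-at cs ds) ⟩
    A (B (B f)) k ⊕ M ⊗ A (B f') k ⊕ M ⊗ A (A f') k
      ≡⟨ cong (λ x → x ⊕ M ⊗ A (B f') k ⊕ M ⊗ A (A f') k)
         (trans (mulLins-comm cs ds (B f) k) (mulLins-cong ds (mulLins-comm cs ds f) k)) ⟩
    B (B (A f)) k ⊕ M ⊗ A (B f') k ⊕ M ⊗ A (A f') k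
      ≡⟨ cong (λ x → x ⊕ M ⊗ A (B f') k ⊕ M ⊗ A (A f') k) (diff-at ds ds) ⟩
    B (B (B f)) k ⊕ M ⊗ B (B f') k ⊕ M ⊗ A (B f') k ⊕ M ⊗ A (A f') k
      ≡⟨ combine (B (B (B f)) k) N (A (A f') k) (A (B f') k) (B (B f') k) ⟩
    B (B (B f)) k ⊕ M ⊗ (B (B f') k ⊕ A (B f') k ⊕ A (A f') k)
      ≡⟨ cong₂ (λ x y → B (B (B f)) k ⊕ M ⊗ (B (B f') k ⊕ x ⊕ y)) AB≡
         (trans (mulLins-diff p cs f' k) (cong (_⊕ M ⊗ A f'' k) AB≡)) ⟩
    B (B (B f)) k ⊕ M ⊗ (B (B f') k ⊕ (B (B f') k ⊕ M ⊗ r) ⊕ ((B (B f') k ⊕ M ⊗ r) ⊕ M ⊗ A f'' k))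
      ≡⟨ third (B (B (B f)) k) N (B (B f') k) (r) (A f'' k) ⟩
    B (B (B f)) k ⊕ (+ 3 ⊗ M) ⊗ (B (B f') k ⊕ N ⊗ (r ⊕ r ⊕ A f'' k))
      ≡⟨ cong (_⊕ (+ 3 ⊗ M) ⊗ (B (B f') k ⊕ N ⊗ (r ⊕ r ⊕ A f'' k))) (cube-≡ ds f k) ⟨
    mulLins (cube ds) f k ⊕ (+ 3 ⊗ M) ⊗ (B (B f') k ⊕ N ⊗ (r ⊕ r ⊕ A f'' k)) ∎)
    where
    -- f' is (A f - B f) / M, f'' is (A f' - B f') / M, and r is the same quotient for B f' at k.
    f' f'' : ℕ → ℤ
    f'  k = proj₁ (diff p f k)
    f'' k = proj₁ (diff p f' k)
    r : ℤ
    r = proj₁ (diff p (B f') k)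
    AB≡ : A (B f') k ≡ B (B f') k ⊕ M ⊗ r
    AB≡ = proj₂ (diff p (B f') k)
    diff-at : ∀ es es' → mulLins es (mulLins es' (A f)) k ≡
      mulLins es (mulLins es' (B f)) k ⊕ M ⊗ mulLins es (mulLins es' f') k
    diff-at es es' = trans (mulLins-cong es (mulLins-diff p es' f) k)
      (mulLins-linear es M (mulLins es' (B f)) (mulLins es' f') k)

≈-single : ∀ {M} c d q → c ≡ d ⊕ M ⊗ q → (c ∷ []) ≈[ M ] (d ∷ [])
≈-single {M} c d q refl = congruent λ f k → ⊝ q ⊗ f k , trans (mulLin-shift d (M ⊗ q) f k) (lemma (mulLin d f k) M q (f k))
  where
  lemma : ∀ x M q y → x ⊕ ⊝ (M ⊗ q) ⊗ y ≡ x ⊕ M ⊗ (⊝ q ⊗ y)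
  lemma = ℤSolver.solve-∀

mulLin-pair : ∀ c d e f k → mulLin (c ⊕ d) (mulLin (c ⊕ e) f) k ≡
  mulLin c (mulLin c f) k ⊕ ((d ⊗ e) ⊗ f k ⊕ ⊝ ((d ⊕ e) ⊗ mulLin c f k))
mulLin-pair c d e f k = begin
  mulLin (c ⊕ d) (mulLin (c ⊕ e) f) k
    ≡⟨ mulLin-cong (c ⊕ d) (mulLin-shift c e f) k ⟩
  mulLin (c ⊕ d) (λ k → mulLin c f k ⊕ ⊝ e ⊗ f k) k
    ≡⟨ mulLin-shift c d (λ k → mulLin c f k ⊕ ⊝ e ⊗ f k) k ⟩
  mulLin c (λ k → mulLin c f k ⊕ ⊝ e ⊗ f k) k ⊕ ⊝ d ⊗ (mulLin c f k ⊕ ⊝ e ⊗ f k)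
    ≡⟨ cong (_⊕ ⊝ d ⊗ (mulLin c f k ⊕ ⊝ e ⊗ f k)) (mulLin-linear c (⊝ e) (mulLin c f) f k) ⟩
  mulLin c (mulLin c f) k ⊕ ⊝ e ⊗ mulLin c f k ⊕ ⊝ d ⊗ (mulLin c f k ⊕ ⊝ e ⊗ f k)
    ≡⟨ regroup (mulLin c (mulLin c f) k) (mulLin c f k) (f k) d e ⟩
  mulLin c (mulLin c f) k ⊕ ((d ⊗ e) ⊗ f k ⊕ ⊝ ((d ⊕ e) ⊗ mulLin c f k)) ∎
  where
  open ≡-Reasoning
  regroup : ∀ x y z d e → x ⊕ ⊝ e ⊗ y ⊕ ⊝ d ⊗ (y ⊕ ⊝ e ⊗ z) ≡ x ⊕ ((d ⊗ e) ⊗ z ⊕ ⊝ ((d ⊕ e) ⊗ y))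
  regroup = ℤSolver.solve-∀

-- (z - c - d)(z - c - e) = (z - c)² - (d + e)(z - c) + de involves only the sum and the product of
-- the increments; neither increment has to be divisible by M on its own.
≈-pair : ∀ {M} c d e s t → d ⊕ e ≡ M ⊗ s → d ⊗ e ≡ M ⊗ t →
         (c ⊕ d ∷ c ⊕ e ∷ []) ≈[ M ] (c ∷ c ∷ [])
≈-pair {M} c d e s t sum prod = congruent λ f k → t ⊗ f k ⊕ ⊝ (s ⊗ mulLin c f k) ,
  trans (mulLin-pair c d e f k)
  (trans (cong₂ (λ x y → mulLin c (mulLin c f) k ⊕ (x ⊗ f k ⊕ ⊝ (y ⊗ mulLin c f k))) prod sum)
    (pull M (mulLin c (mulLin c f) k) (mulLin c f k) (f k) s t))
  where
  pull : ∀ M x y z s t → x ⊕ ((M ⊗ t) ⊗ z ⊕ ⊝ ((M ⊗ s) ⊗ y)) ≡ x ⊕ M ⊗ (t ⊗ z ⊕ ⊝ (s ⊗ y))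
  pull = ℤSolver.solve-∀

-- Products over squares in a residue class modulo 3

roots : (ℕ → ℤ) → ℕ → List ℤ
roots c zero    = []
roots c (suc n) = c n ∷ roots c n

roots-cong : ∀ {c d} → c ≗ d → ∀ n → roots c n ≡ roots d n
roots-cong c≗d zero    = refl
roots-cong c≗d (suc n) = cong₂ _∷_ (c≗d n) (roots-cong c≗d n)

roots-+ : ∀ c m n → roots c (m + n) ≡ roots (λ j → c (j + n)) m ++ roots c n
roots-+ c zero    n = refl
roots-+ c (suc m) n = cong (c (m + n) ∷_) (roots-+ c m n)

length-roots : ∀ c n → length (roots c n) ≡ n
length-roots c zero    = refl
length-roots c (suc n) = cong suc (length-roots c n)

interleave : ∀ (x y z : ℤ) xs ys zs →
  (x ∷ xs) ++ (y ∷ ys) ++ (z ∷ zs) ↭ (x ∷ y ∷ z ∷ []) ++ (xs ++ ys ++ zs)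
interleave x y z xs ys zs = prep x (↭-trans (shift y xs (ys ++ z ∷ zs))
  (prep y (↭-trans (++⁺ˡ xs (shift z ys zs)) (shift z xs (ys ++ zs)))))

-- After regrouping by `interleave`, the three products are compared one triple of roots at a time.
roots-≈ : ∀ {c d e M} → (∀ j → (d j ∷ e j ∷ c j ∷ []) ≈[ M ] (c j ∷ c j ∷ c j ∷ [])) →
  ∀ n → roots d n ++ roots e n ++ roots c n ≈[ M ] cube (roots c n)
roots-≈ h zero = ≈-reflexive ↭-refl
roots-≈ {c} {d} {e} h (suc n) =
  ≈-trans (≈-reflexive (interleave (d n) (e n) (c n) (roots d n) (roots e n) (roots c n)))
  (≈-trans (≈-++ (h n) (roots-≈ h n))
  (≈-reflexive (↭-sym (interleave (c n) (c n) (c n) (roots c n) (roots c n) (roots c n)))))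

sq : ℕ → ℤ
sq n = + n ⊗ + n

residueRoots : ℕ → ℕ → List ℤ
residueRoots r = roots (λ j → sq (r + j * 3))

replicate-+ : ∀ m n (x : ℤ) → replicate (m + n) x ≡ replicate m x ++ replicate n x
replicate-+ zero    n x = refl
replicate-+ (suc m) n x = cong (x ∷_) (replicate-+ m n x)

-- The increments of the two shifted squares have sum and product divisible by 3Q.
shifted-squares : ∀ a X → let c = sq a ; Q = 3 * X in
  (sq (a + 2 * Q) ∷ sq (a + Q) ∷ sq a ∷ []) ≈[ + 3 ⊗ + Q ] (c ∷ c ∷ c ∷ [])
shifted-squares a X = ≈-++ (subst₂ (λ x y → (x ∷ y ∷ []) ≈[ + 3 ⊗ + Q ] (sq a ∷ sq a ∷ []))
    (sym (trans (cong (λ z → (+ a ⊕ z) ⊗ (+ a ⊕ z)) (trans (ℤ.pos-* 2 Q) (cong (+ 2 ⊗_) Q≡))) (expand₂ (+ a) (+ X))))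
    (sym (trans (cong (λ z → (+ a ⊕ z) ⊗ (+ a ⊕ z)) Q≡) (expand₁ (+ a) (+ X))))
    (≈-pair (sq a) (twice (+ a) (+ X)) (once (+ a) (+ X)) (+ 2 ⊗ + a ⊕ + 5 ⊗ + X)
      ((+ 4 ⊗ + a ⊕ + 12 ⊗ + X) ⊗ ((+ 2 ⊗ + a ⊕ + 3 ⊗ + X) ⊗ + X))
      (trans (sum (+ a) (+ X)) (cong (λ z → (+ 3 ⊗ z) ⊗ (+ 2 ⊗ + a ⊕ + 5 ⊗ + X)) (sym Q≡)))
      (trans (prod (+ a) (+ X)) (cong (λ z → (+ 3 ⊗ z) ⊗ ((+ 4 ⊗ + a ⊕ + 12 ⊗ + X) ⊗ ((+ 2 ⊗ + a ⊕ + 3 ⊗ + X) ⊗ + X))) (sym Q≡)))))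
  (≈-reflexive ↭-refl)
  where
  Q = 3 * X
  Q≡ : + Q ≡ + 3 ⊗ + X
  Q≡ = ℤ.pos-* 3 X
  -- These are (a + Q)² - a² and (a + 2Q)² - a². Modulo 3Q they are 2aQ and 4aQ, because 3 divides
  -- Q; hence the extra factor 3 in their sum.
  once twice : ℤ → ℤ → ℤ
  once  a X = + 3 ⊗ X ⊗ (+ 2 ⊗ a ⊕ + 3 ⊗ X)
  twice a X = + 3 ⊗ X ⊗ (+ 4 ⊗ a ⊕ + 12 ⊗ X)
  expand₁ : ∀ a X → (a ⊕ + 3 ⊗ X) ⊗ (a ⊕ + 3 ⊗ X) ≡ a ⊗ a ⊕ + 3 ⊗ X ⊗ (+ 2 ⊗ a ⊕ + 3 ⊗ X)
  expand₁ = ℤSolver.solve-∀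
  expand₂ : ∀ a X → (a ⊕ + 2 ⊗ (+ 3 ⊗ X)) ⊗ (a ⊕ + 2 ⊗ (+ 3 ⊗ X)) ≡ a ⊗ a ⊕ + 3 ⊗ X ⊗ (+ 4 ⊗ a ⊕ + 12 ⊗ X)
  expand₂ = ℤSolver.solve-∀
  sum : ∀ a X → + 3 ⊗ X ⊗ (+ 4 ⊗ a ⊕ + 12 ⊗ X) ⊕ + 3 ⊗ X ⊗ (+ 2 ⊗ a ⊕ + 3 ⊗ X)
        ≡ (+ 3 ⊗ (+ 3 ⊗ X)) ⊗ (+ 2 ⊗ a ⊕ + 5 ⊗ X)
  sum = ℤSolver.solve-∀
  prod : ∀ a X → (+ 3 ⊗ X ⊗ (+ 4 ⊗ a ⊕ + 12 ⊗ X)) ⊗ (+ 3 ⊗ X ⊗ (+ 2 ⊗ a ⊕ + 3 ⊗ X))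
        ≡ (+ 3 ⊗ (+ 3 ⊗ X)) ⊗ ((+ 4 ⊗ a ⊕ + 12 ⊗ X) ⊗ ((+ 2 ⊗ a ⊕ + 3 ⊗ X) ⊗ X))
  prod = ℤSolver.solve-∀

-- With X = 3^m, the indices below 3X form triples j, j + X, j + 2X, whose bases differ by multiples
-- of 3X. By `shifted-squares` the product is the cube of the one over j < X modulo 9X, and cubing
-- the induction hypothesis raises its modulus from 3X to 9X.
residueRoots-≈ : ∀ r q → sq r ≡ + 1 ⊕ + 3 ⊗ q → ∀ m →
  residueRoots r (3 ^ m) ≈[ + 3 ⊗ + (3 ^ m) ] replicate (3 ^ m) (+ 1)
residueRoots-≈ r q sq-r zero = ≈-single (sq (r + 0)) (+ 1) q (trans (cong sq (+-identityʳ r)) sq-r)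
residueRoots-≈ r q sq-r (suc m) =
  subst₂ (λ xs ys → xs ≈[ + 3 ⊗ + (3 * X) ] ys) (sym split) (sym ones)
    (≈-trans (roots-≈ {c = λ j → sq (r + j * 3)} (λ j → shifted-squares (r + j * 3) X) X)
      (subst (λ z → cube (residueRoots r X) ≈[ + 3 ⊗ z ] cube (replicate X (+ 1))) (sym (ℤ.pos-* 3 X))
        (≈-cube {N = + X} (residueRoots-≈ r q sq-r m))))
  where
  X = 3 ^ m
  ones : replicate (3 * X) (+ 1) ≡ cube (replicate X (+ 1))
  ones = trans (cong (λ z → replicate (X + (X + z)) (+ 1)) (+-identityʳ X))
    (trans (replicate-+ X (X + X) (+ 1)) (cong (replicate X (+ 1) ++_) (replicate-+ X X (+ 1))))
  shift₁ : ∀ r j X → r + (j + X) * 3 ≡ r + j * 3 + 3 * X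
  shift₁ = ℕSolver.solve-∀
  shift₂ : ∀ r j X → r + (j + (X + X)) * 3 ≡ r + j * 3 + 2 * (3 * X)
  shift₂ = ℕSolver.solve-∀
  split : residueRoots r (3 * X) ≡
    roots (λ j → sq (r + j * 3 + 2 * (3 * X))) X ++ roots (λ j → sq (r + j * 3 + 3 * X)) X ++ residueRoots r X
  split = trans (cong (λ z → residueRoots r (X + (X + z))) (+-identityʳ X))
    (trans (roots-+ (λ j → sq (r + j * 3)) X (X + X))
      (cong₂ _++_ (roots-cong (λ j → cong sq (shift₂ r j X)) X)
        (trans (roots-+ (λ j → sq (r + j * 3)) X X)
          (cong (_++ residueRoots r X) (roots-cong (λ j → cong sq (shift₁ r j X)) X)))))

-- Binomial coefficients and convolutions

v3-complement : ∀ m x y → .{{NonZero x}} → .{{NonZero y}} → 3 ^ m ℕ∣.∣ x + y → v3 x ≤ m → v3 x ≤ v3 y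
v3-complement m x y d v≤ = 3^∣⇒≤v3 (v3 x) y
  (ℕ∣.∣m+n∣m⇒∣n (ℕ∣.∣-trans (ℕ3^-∣ v≤) d) (3^v3∣ x))
  where
  ℕ3^-∣ : ∀ {a b} → a ≤ b → 3 ^ a ℕ∣.∣ 3 ^ b
  ℕ3^-∣ a≤b = ∣⇒∣ᵤ (3^-∣ a≤b)

-- bin a b is the binomial coefficient (a + b) choose a.
bin : ℕ → ℕ → ℕ
bin zero    b       = 1
bin (suc a) zero    = 1
bin (suc a) (suc b) = bin a (suc b) + bin (suc a) b

bin-zeroʳ : ∀ a → bin a 0 ≡ 1
bin-zeroʳ zero    = refl
bin-zeroʳ (suc a) = refl

bin≢0 : ∀ a b → NonZero (bin a b)
bin≢0 zero    b       = _
bin≢0 (suc a) zero    = _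
bin≢0 (suc a) (suc b) = >-nonZero (≤-trans (>-nonZero⁻¹ _ {{bin≢0 a (suc b)}}) (m≤m+n _ _))

bin-absorbˡ : ∀ a b → suc a * bin (suc a) b ≡ (suc a + b) * bin a b
bin-absorbˡ a zero = trans (lemma a) (cong ((suc a + 0) *_) (sym (bin-zeroʳ a)))
  where
  lemma : ∀ a → suc a * 1 ≡ (suc a + 0) * 1
  lemma = ℕSolver.solve-∀
bin-absorbˡ zero (suc b) = trans (lemma₁ (bin 1 b)) (trans (cong suc (bin-absorbˡ zero b)) (lemma₂ b))
  where
  lemma₁ : ∀ x → 1 * (1 + x) ≡ suc (1 * x)
  lemma₁ = ℕSolver.solve-∀
  lemma₂ : ∀ b → suc ((1 + b) * 1) ≡ (1 + suc b) * 1
  lemma₂ = ℕSolver.solve-∀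
bin-absorbˡ (suc a) (suc b) = +-cancelʳ-≡ _ _ _ (begin
  suc (suc a) * (x + y + z) + (suc a + suc b) * x           ≡⟨ lemma₁ a b x y z ⟩
  suc (suc a) * (x + y) + suc (suc a) * z + (suc a + suc b) * x
    ≡⟨ cong (λ t → suc (suc a) * (x + y) + t + (suc a + suc b) * x) (bin-absorbˡ (suc a) b) ⟩
  suc (suc a) * (x + y) + (suc (suc a) + b) * y + (suc a + suc b) * x
    ≡⟨ lemma₂ a b x y ⟩
  (suc (suc a) + suc b) * (x + y) + suc a * (x + y)
    ≡⟨ cong (λ t → (suc (suc a) + suc b) * (x + y) + t) (bin-absorbˡ a (suc b)) ⟩
  (suc (suc a) + suc b) * (x + y) + (suc a + suc b) * x     ∎)
  where
  open ≡-Reasoning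
  x y z : ℕ
  x = bin a (suc b)
  y = bin (suc a) b
  z = bin (suc (suc a)) b
  lemma₁ : ∀ a b x y z → suc (suc a) * (x + y + z) + (suc a + suc b) * x ≡
           suc (suc a) * (x + y) + suc (suc a) * z + (suc a + suc b) * x
  lemma₁ = ℕSolver.solve-∀
  lemma₂ : ∀ a b x y → suc (suc a) * (x + y) + (suc (suc a) + b) * y + (suc a + suc b) * x ≡
           (suc (suc a) + suc b) * (x + y) + suc a * (x + y)
  lemma₂ = ℕSolver.solve-∀

bin-absorbʳ : ∀ a b → suc b * bin a (suc b) ≡ (a + suc b) * bin a b
bin-absorbʳ zero    b = refl
bin-absorbʳ (suc a) b = +-cancelʳ-≡ _ _ _ (begin
  suc b * (x + y) + (suc a + suc b) * x            ≡⟨ cong (λ t → suc b * (x + y) + t) (bin-absorbˡ a (suc b)) ⟨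
  suc b * (x + y) + suc a * (x + y)                ≡⟨ lemma a b x y ⟩
  (suc a + suc b) * y + (suc a + suc b) * x        ∎)
  where
  open ≡-Reasoning
  x y : ℕ
  x = bin a (suc b)
  y = bin (suc a) b
  lemma : ∀ a b x y → suc b * (x + y) + suc a * (x + y) ≡ (suc a + suc b) * y + (suc a + suc b) * x
  lemma = ℕSolver.solve-∀

bin-exchange : ∀ a b → suc a * bin (suc a) b ≡ suc b * bin a (suc b)
bin-exchange a b = trans (bin-absorbˡ a b) (trans (cong (_* bin a b) (sym (+-suc a b))) (sym (bin-absorbʳ a b)))

v3-2*3^ : ∀ m → v3 (2 * 3 ^ m) ≡ m
v3-2*3^ m = Val⇒v3 (+ (2 * 3 ^ m)) (val (+ 2) (trans (ℤ.pos-* 2 (3 ^ m)) (ℤ.*-comm (+ 2) (+ (3 ^ m)))) (λ d → from-no (3 ℕ∣.∣? 2) (∣⇒∣ᵤ d)))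

<2*3^⇒v3≤ : ∀ m x y → suc x + suc y ≡ 2 * 3 ^ m → v3 (suc x) ≤ m
<2*3^⇒v3≤ m x y eq = ≤-pred (<3^⇒v3< (suc m) (suc x)
  (≤-trans (m≤m+n (suc (suc x)) y) (≤-trans (≤-reflexive (trans (sym (+-suc (suc x) y)) eq)) (*-monoˡ-≤ (3 ^ m) {2} {3} (s≤s (s≤s z≤n))))))

v3-symmetric : ∀ m x y → suc x + suc y ≡ 2 * 3 ^ m → v3 (suc x) ≡ v3 (suc y)
v3-symmetric m x y eq = ≤-antisym
  (v3-complement m (suc x) (suc y) (ℕ∣.divides 2 eq) (<2*3^⇒v3≤ m x y eq))
  (v3-complement m (suc y) (suc x) (ℕ∣.divides 2 eq') (<2*3^⇒v3≤ m y x eq'))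
  where eq' = trans (+-comm (suc y) (suc x)) eq

-- In row N - 1 with N = 2 · 3^m, neighbouring binomial coefficients have ratio (N - e)/e, and v(N -
-- e) = v(e); so all of them are prime to 3, like the first.
v3-bin≡0 : ∀ m a b → suc (a + b) ≡ 2 * 3 ^ m → v3 (bin a b) ≡ 0
v3-bin≡0 m zero    b eq = refl
v3-bin≡0 m (suc a) b eq = +-cancelˡ-≡ (v3 (suc a)) _ _ (begin
  v3 (suc a) + v3 (bin (suc a) b)    ≡⟨ v3-* (suc a) (bin (suc a) b) {{_}} {{bin≢0 (suc a) b}} ⟨
  v3 (suc a * bin (suc a) b)         ≡⟨ cong v3 (bin-exchange a b) ⟩
  v3 (suc b * bin a (suc b))         ≡⟨ v3-* (suc b) (bin a (suc b)) {{_}} {{bin≢0 a (suc b)}} ⟩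
  v3 (suc b) + v3 (bin a (suc b))    ≡⟨ cong₂ _+_ (sym (v3-symmetric m a b eq')) (v3-bin≡0 m a (suc b) eq') ⟩
  v3 (suc a) + 0                     ∎)
  where
  open ≡-Reasoning
  eq' : suc (a + suc b) ≡ 2 * 3 ^ m
  eq' = trans (cong suc (+-suc a b)) eq

-- C(N, e) = (N/e) C(N - 1, e - 1) for N = 2 · 3^m, where the last factor is prime to 3 and v(N) =
-- m.
v3-bin : ∀ m a b → suc a + b ≡ 2 * 3 ^ m → v3 (suc a) + v3 (bin (suc a) b) ≡ m
v3-bin m a b eq = begin
  v3 (suc a) + v3 (bin (suc a) b)    ≡⟨ v3-* (suc a) (bin (suc a) b) {{_}} {{bin≢0 (suc a) b}} ⟨
  v3 (suc a * bin (suc a) b)         ≡⟨ cong v3 (bin-absorbˡ a b) ⟩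
  v3 ((suc a + b) * bin a b)         ≡⟨ v3-* (suc a + b) (bin a b) {{_}} {{bin≢0 a b}} ⟩
  v3 (suc a + b) + v3 (bin a b)      ≡⟨ cong₂ _+_ (trans (cong v3 eq) (v3-2*3^ m)) (v3-bin≡0 m a b eq) ⟩
  m + 0                              ≡⟨ +-identityʳ m ⟩
  m                                  ∎
  where open ≡-Reasoning

mulLins-replicate : ∀ c k b → mulLins (replicate (k + b) c) one k ≡ (⊝ c) ⊗^ b ⊗ + bin k b
mulLins-replicate c zero zero = refl
mulLins-replicate c zero (suc b) = trans (cong (λ x → ⊝ (c ⊗ x)) (mulLins-replicate c zero b))
  (lemma c ((⊝ c) ⊗^ b))
  where
  lemma : ∀ c x → ⊝ (c ⊗ (x ⊗ + 1)) ≡ (⊝ c ⊗ x) ⊗ + 1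
  lemma = ℤSolver.solve-∀
mulLins-replicate c (suc k) zero = trans
  (cong₂ (λ x y → x ⊕ ⊝ (c ⊗ y)) (trans (mulLins-replicate c k zero) (cong (λ z → + 1 ⊗ + z) (bin-zeroʳ k)))
    (mulLins-degree (replicate (k + 0) c) (suc k) (s≤s (≤-reflexive (trans (length-replicate (k + 0)) (+-identityʳ k))))))
  (lemma c)
  where
  lemma : ∀ c → + 1 ⊗ + 1 ⊕ ⊝ (c ⊗ + 0) ≡ + 1 ⊗ + 1
  lemma = ℤSolver.solve-∀
mulLins-replicate c (suc k) (suc b) = trans
  (cong₂ (λ x y → x ⊕ ⊝ (c ⊗ y)) (mulLins-replicate c k (suc b))
    (trans (cong (λ n → mulLins (replicate n c) one (suc k)) (+-suc k b)) (mulLins-replicate c (suc k) b)))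
  (lemma c ((⊝ c) ⊗^ b) (+ bin k (suc b)) (+ bin (suc k) b))
  where
  lemma : ∀ c q x y → (⊝ c ⊗ q) ⊗ x ⊕ ⊝ (c ⊗ (q ⊗ y)) ≡ (⊝ c ⊗ q) ⊗ (x ⊕ y)
  lemma = ℤSolver.solve-∀

-- Convolution sums and dominant terms

dot : ℕ → (ℕ → ℤ) → (ℕ → ℤ) → ℤ
dot zero    f g = + 0
dot (suc n) f g = f 0 ⊗ g 0 ⊕ dot n (f ∘ suc) (g ∘ suc)

dot-∣ : ∀ {d} n f g → (∀ a → a < n → d ∣ f a ⊗ g a) → d ∣ dot n f g
dot-∣ {d} zero f g h = divides (+ 0) refl
dot-∣ (suc n) f g h = ∣m∣n⇒∣m+n (h 0 (s≤s z≤n)) (dot-∣ n (f ∘ suc) (g ∘ suc) (λ a a<n → h (suc a) (s≤s a<n)))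

dot-dominant : ∀ {d} n f g i → i < n → (∀ a → a < n → a ≢ i → d ∣ f a ⊗ g a) →
  d ∣ dot n f g ⊖ f i ⊗ g i
dot-dominant {d} (suc n) f g zero i<n h = subst (d ∣_) (lemma (f 0 ⊗ g 0) (dot n (f ∘ suc) (g ∘ suc)))
  (dot-∣ n (f ∘ suc) (g ∘ suc) (λ a a<n → h (suc a) (s≤s a<n) (λ ())))
  where
  lemma : ∀ x y → y ≡ x ⊕ y ⊕ ⊝ x
  lemma = ℤSolver.solve-∀
dot-dominant {d} (suc n) f g (suc i) (s≤s i<n) h = subst (d ∣_)
  (lemma (f 0 ⊗ g 0) (dot n (f ∘ suc) (g ∘ suc)) (f (suc i) ⊗ g (suc i)))
  (∣m∣n⇒∣m+n (h 0 (s≤s z≤n) (λ ()))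
    (dot-dominant n (f ∘ suc) (g ∘ suc) i i<n (λ a a<n a≢i → h (suc a) (s≤s a<n) (a≢i ∘ suc-injective))))
  where
  lemma : ∀ x y z → x ⊕ (y ⊕ ⊝ z) ≡ x ⊕ y ⊕ ⊝ z
  lemma = ℤSolver.solve-∀

Val-dot : ∀ {w} n f g i → i < n → Val w (f i ⊗ g i) →
  (∀ a → a < n → a ≢ i → + (3 ^ suc w) ∣ f a ⊗ g a) → Val w (dot n f g)
Val-dot n f g i i<n v h = Val-dominant v (dot-dominant n f g i i<n h)

dot-linearˡ : ∀ n c f f' g → dot n (λ a → f a ⊕ ⊝ (c ⊗ f' a)) g ≡ dot n f g ⊕ ⊝ (c ⊗ dot n f' g)
dot-linearˡ zero c f f' g = lemma c
  where
  lemma : ∀ c → + 0 ≡ + 0 ⊕ ⊝ (c ⊗ + 0)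
  lemma = ℤSolver.solve-∀
dot-linearˡ (suc n) c f f' g = trans (cong (λ t → (f 0 ⊕ ⊝ (c ⊗ f' 0)) ⊗ g 0 ⊕ t) (dot-linearˡ n c (f ∘ suc) (f' ∘ suc) (g ∘ suc)))
  (lemma c (f 0) (f' 0) (g 0) (dot n (f ∘ suc) (g ∘ suc)) (dot n (f' ∘ suc) (g ∘ suc)))
  where
  lemma : ∀ c x x' y d d' → (x ⊕ ⊝ (c ⊗ x')) ⊗ y ⊕ (d ⊕ ⊝ (c ⊗ d')) ≡ x ⊗ y ⊕ d ⊕ ⊝ (c ⊗ (x' ⊗ y ⊕ d'))
  lemma = ℤSolver.solve-∀

-- Multiplication of f by z becomes a shift of g. The product of f n with g (suc n) lies outside the
-- range, so the shifted sum is one term shorter.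
dot-mulLin : ∀ n c f g → dot (suc n) (mulLin c f) g ≡ dot n f (g ∘ suc) ⊕ ⊝ (c ⊗ dot (suc n) f g)
dot-mulLin n c f g = trans (cong (λ t → ⊝ (c ⊗ f 0) ⊗ g 0 ⊕ t) (dot-linearˡ n c f (f ∘ suc) (g ∘ suc)))
  (lemma c (f 0) (g 0) (dot n f (g ∘ suc)) (dot n (f ∘ suc) (g ∘ suc)))
  where
  lemma : ∀ c x y d d' → ⊝ (c ⊗ x) ⊗ y ⊕ (d ⊕ ⊝ (c ⊗ d')) ≡ d ⊕ ⊝ (c ⊗ (x ⊗ y ⊕ d'))
  lemma = ℤSolver.solve-∀

mulLins-convolution : ∀ cs f i → mulLins cs f i ≡ dot (suc i) (mulLins cs one) (λ a → f (i ∸ a))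
mulLins-convolution [] f i = sym (trans (cong (λ t → + 1 ⊗ f i ⊕ t) (zeros i (λ a → f (i ∸ suc a)))) (lemma (f i)))
  where
  zeros : ∀ n g → dot n (λ a → + 0) g ≡ + 0
  zeros zero    g = refl
  zeros (suc n) g = trans (cong (λ t → + 0 ⊗ g 0 ⊕ t) (zeros n (g ∘ suc))) (trans (ℤ.+-identityʳ (+ 0 ⊗ g 0)) (ℤ.*-zeroˡ (g 0)))
  lemma : ∀ x → + 1 ⊗ x ⊕ + 0 ≡ x
  lemma = ℤSolver.solve-∀
mulLins-convolution (c ∷ cs) f zero = trans (cong (λ x → ⊝ (c ⊗ x)) (mulLins-convolution cs f 0))
  (trans (sym (ℤ.+-identityˡ _)) (sym (dot-mulLin 0 c (mulLins cs one) (λ a → f (0 ∸ a)))))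
mulLins-convolution (c ∷ cs) f (suc i) = trans
  (cong₂ (λ x y → x ⊕ ⊝ (c ⊗ y)) (mulLins-convolution cs f i) (mulLins-convolution cs f (suc i)))
  (sym (dot-mulLin (suc i) c (mulLins cs one) (λ a → f (suc i ∸ a))))

-- Scaling the roots by q turns P(z) into q^deg P(z/q), so a coefficient gains one factor q per
-- degree below the top; b is this distance, passed explicitly to avoid subtraction.
mulLins-scale : ∀ q cs a b → length cs ≡ a + b →
  mulLins (map (q ⊗_) cs) one a ≡ q ⊗^ b ⊗ mulLins cs one a
mulLins-scale q []       zero zero    eq = refl
mulLins-scale q (c ∷ cs) zero (suc b) eq = trans
  (cong (λ x → ⊝ (q ⊗ c ⊗ x)) (mulLins-scale q cs zero b (suc-injective eq)))
  (lemma q c (q ⊗^ b) (mulLins cs one 0))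
  where
  lemma : ∀ q c r x → ⊝ (q ⊗ c ⊗ (r ⊗ x)) ≡ (q ⊗ r) ⊗ ⊝ (c ⊗ x)
  lemma = ℤSolver.solve-∀
mulLins-scale q (c ∷ cs) (suc a) zero eq = trans
  (cong₂ (λ x y → x ⊕ ⊝ (q ⊗ c ⊗ y)) (mulLins-scale q cs a zero (suc-injective eq))
    (mulLins-degree (map (q ⊗_) cs) (suc a) (s≤s (≤-reflexive (trans (length-map (q ⊗_) cs) len)))))
  (trans (lemma q c (mulLins cs one a))
    (cong (λ y → + 1 ⊗ (mulLins cs one a ⊕ ⊝ (c ⊗ y))) (sym (mulLins-degree cs (suc a) (s≤s (≤-reflexive len))))))
  where
  len : length cs ≡ a
  len = trans (suc-injective eq) (+-identityʳ a)
  lemma : ∀ q c x → + 1 ⊗ x ⊕ ⊝ (q ⊗ c ⊗ + 0) ≡ + 1 ⊗ (x ⊕ ⊝ (c ⊗ + 0))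
  lemma = ℤSolver.solve-∀
mulLins-scale q (c ∷ cs) (suc a) (suc b) eq = trans
  (cong₂ (λ x y → x ⊕ ⊝ (q ⊗ c ⊗ y)) (mulLins-scale q cs a (suc b) (suc-injective eq))
    (mulLins-scale q cs (suc a) b (trans (suc-injective eq) (+-suc a b))))
  (lemma q c (q ⊗^ b) (mulLins cs one a) (mulLins cs one (suc a)))
  where
  lemma : ∀ q c r x y → (q ⊗ r) ⊗ x ⊕ ⊝ (q ⊗ c ⊗ (r ⊗ y)) ≡ (q ⊗ r) ⊗ (x ⊕ ⊝ (c ⊗ y))
  lemma = ℤSolver.solve-∀

squareRoots-split : ∀ n → roots sq (n * 3) ↭ map (+ 9 ⊗_) (roots sq n) ++ residueRoots 1 n ++ residueRoots 2 n
squareRoots-split zero = ↭-refl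
squareRoots-split (suc n) = ↭-trans
  (↭-trans (swap _ _ ↭-refl) (↭-trans (prep _ (swap _ _ ↭-refl)) (swap _ _ ↭-refl)))
  (↭-trans (prep _ (prep _ (prep _ (squareRoots-split n))))
  (subst (λ x → x ∷ sq (1 + n * 3) ∷ sq (2 + n * 3) ∷ rest ↭ map (+ 9 ⊗_) (roots sq (suc n)) ++ residueRoots 1 (suc n) ++ residueRoots 2 (suc n))
    (sym nine) (↭-sym (interleave (+ 9 ⊗ sq n) (sq (1 + n * 3)) (sq (2 + n * 3)) (map (+ 9 ⊗_) (roots sq n)) (residueRoots 1 n) (residueRoots 2 n)))))
  where
  rest = map (+ 9 ⊗_) (roots sq n) ++ residueRoots 1 n ++ residueRoots 2 n
  lemma : ∀ x → (x ⊗ + 3) ⊗ (x ⊗ + 3) ≡ + 9 ⊗ (x ⊗ x)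
  lemma = ℤSolver.solve-∀
  nine : sq (n * 3) ≡ + 9 ⊗ sq n
  nine = trans (cong₂ _⊗_ (ℤ.pos-* n 3) (ℤ.pos-* n 3)) (lemma (+ n))

-- The factor U of p_(m+1): its roots are the j² with j < 3^(m+1) prime to 3.
unitFactor : ℕ → ℕ → ℤ
unitFactor m = mulLins (residueRoots 1 (3 ^ m) ++ residueRoots 2 (3 ^ m)) one

unitFactor-≡ : ∀ m e b → e + b ≡ 2 * 3 ^ m →
  ∃ λ q → unitFactor m e ≡ (⊝ + 1) ⊗^ b ⊗ + bin e b ⊕ + (3 ^ suc m) ⊗ q
unitFactor-≡ m e b eq =
  -- The quotients 0 and 1 come from 1² = 1 + 3 · 0 and 2² = 1 + 3 · 1.
  let q , eq' = diff (≈-++ (residueRoots-≈ 1 (+ 0) refl m) (residueRoots-≈ 2 (+ 1) refl m)) one e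
  in q , trans eq' (cong₂ (λ x y → x ⊕ y ⊗ q)
    (trans (cong (λ cs → mulLins cs one e) (trans (sym (replicate-+ (3 ^ m) (3 ^ m) (+ 1)))
      (cong (λ n → replicate n (+ 1)) (trans (cong (λ t → 3 ^ m + t) (sym (+-identityʳ (3 ^ m)))) (sym eq)))))
      (mulLins-replicate (+ 1) e b))
    (sym (ℤ.pos-* 3 (3 ^ m))))

Val-signs : ∀ b → Val 0 ((⊝ + 1) ⊗^ b)
Val-signs zero    = Val-1
Val-signs (suc b) = Val-* {0} {0} (val (⊝ + 1) refl (λ d → from-no (3 ℕ∣.∣? 1) (∣⇒∣ᵤ d))) (Val-signs b)

-- The error in `unitFactor-≡` is divisible by 3^(m+1), one power beyond any w ≤ m, so the valuation
-- of the binomial coefficient is inherited.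
Val-unitFactor′ : ∀ m e b w → e + b ≡ 2 * 3 ^ m → v3 (bin e b) ≡ w → w ≤ m → Val w (unitFactor m e)
Val-unitFactor′ m e b w eq v≡w w≤m =
  let q , eq' = unitFactor-≡ m e b eq
  in Val-dominant (Val-* (Val-signs b) (subst (λ v → Val v (+ bin e b)) v≡w (v3-Val (bin e b) {{bin≢0 e b}})))
    (subst (+ (3 ^ suc w) ∣_) (trans (lemma ((⊝ + 1) ⊗^ b ⊗ + bin e b) (+ (3 ^ suc m) ⊗ q)) (cong (_⊖ (⊝ + 1) ⊗^ b ⊗ + bin e b) (sym eq')))
      (∣m⇒∣m*n q (3^-∣ (s≤s w≤m))))
  where
  lemma : ∀ x y → y ≡ x ⊕ y ⊕ ⊝ x
  lemma = ℤSolver.solve-∀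

Val-unitFactor-0 : ∀ m → Val 0 (unitFactor m 0)
Val-unitFactor-0 m = Val-unitFactor′ m 0 (2 * 3 ^ m) 0 refl refl z≤n

Val-unitFactor : ∀ m e → suc e ≤ 2 * 3 ^ m → Val (m ∸ v3 (suc e)) (unitFactor m (suc e))
Val-unitFactor m e e≤ = Val-unitFactor′ m (suc e) b (m ∸ v3 (suc e)) eq
  (trans (sym (m+n∸m≡n (v3 (suc e)) (v3 (bin (suc e) b)))) (cong (_∸ v3 (suc e)) (v3-bin m e b eq))) (m∸n≤m m (v3 (suc e)))
  where
  b = 2 * 3 ^ m ∸ suc e
  eq : suc e + b ≡ 2 * 3 ^ m
  eq = m+[n∸m]≡n e≤

-- Beyond the degree of U the coefficient is 0, so plain divisibility needs no range condition on e,
-- unlike `Val`.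
unitFactor-∣ : ∀ m e → + (3 ^ (m ∸ v3 (suc e))) ∣ unitFactor m (suc e)
unitFactor-∣ m e with suc e ≤? 2 * 3 ^ m
... | yes e≤ = Val⇒∣ (Val-unitFactor m e e≤)
... | no  e≰ = subst (+ (3 ^ (m ∸ v3 (suc e))) ∣_)
  (sym (mulLins-degree (residueRoots 1 (3 ^ m) ++ residueRoots 2 (3 ^ m)) (suc e)
    (≤-trans (s≤s (≤-reflexive len)) (≰⇒> e≰))))
  (divides (+ 0) refl)
  where
  len : length (residueRoots 1 (3 ^ m) ++ residueRoots 2 (3 ^ m)) ≡ 2 * 3 ^ m
  len = trans (length-++ (residueRoots 1 (3 ^ m)))
    (cong₂ _+_ (length-roots _ (3 ^ m)) (trans (length-roots _ (3 ^ m)) (sym (+-identityʳ (3 ^ m)))))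

-- The coefficients of ∏ (z − j²)

-- The valuation of the coefficient of zⁱ in ∏_{j<3^m} (z − j²), for 1 ≤ i ≤ 3^m.
w : ℕ → ℕ → ℕ
w zero    i = 0
w (suc m) i with i ≤? 3 ^ m
... | yes _ = w m i + 2 * (3 ^ m ∸ i)
... | no  _ = m ∸ v3 (i ∸ 3 ^ m)

w-low : ∀ m i d → i + d ≡ 3 ^ m → w (suc m) i ≡ w m i + 2 * d
w-low m i d eq with i ≤? 3 ^ m
... | yes _ = cong (λ z → w m i + 2 * z) (trans (cong (_∸ i) (sym eq)) (m+n∸m≡n i d))
... | no i≰ = ⊥-elim (i≰ (subst (i ≤_) eq (m≤m+n i d)))

w-high : ∀ m j → 0 < j → w (suc m) (3 ^ m + j) ≡ m ∸ v3 j
w-high m j 0<j with 3 ^ m + j ≤? 3 ^ m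
... | yes p = ⊥-elim (<⇒≱ (m<m+n (3 ^ m) 0<j) p)
... | no  _ = cong (λ z → m ∸ v3 z) (m+n∸m≡n (3 ^ m) j)

compare-sum : ∀ i X → (∃ λ d → i + d ≡ X) ⊎ (∃ λ j → i ≡ X + j × 0 < j)
compare-sum i X with i ≤? X
... | yes i≤X = inj₁ (X ∸ i , m+[n∸m]≡n i≤X)
... | no  i≰X = inj₂ (i ∸ X , sym (m+[n∸m]≡n (<⇒≤ (≰⇒> i≰X))) , m<n⇒0<n∸m (≰⇒> i≰X))

w-top : ∀ m → w m (3 ^ m) ≡ 0
w-top zero    = refl
w-top (suc m) = trans (w-high m (2 * 3 ^ m) (≤-trans (m^n>0 3 m) (m≤m+n (3 ^ m) _)))
  (trans (cong (m ∸_) (v3-2*3^ m)) (n∸n≡0 m))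

w-high-≤ : ∀ m i → 3 ^ m ≤ i → w (suc m) i ≤ m
w-high-≤ m i X≤i with compare-sum i (3 ^ m)
... | inj₁ (d , eq) = subst (λ z → w (suc m) z ≤ m) X≡i
        (≤-trans (≤-reflexive (trans (w-low m (3 ^ m) 0 (+-identityʳ (3 ^ m))) (trans (+-identityʳ _) (w-top m)))) z≤n)
  where
  X≡i : 3 ^ m ≡ i
  X≡i = ≤-antisym X≤i (subst (i ≤_) eq (m≤m+n i d))
... | inj₂ (j , refl , 0<j) = ≤-trans (≤-reflexive (w-high m j 0<j)) (m∸n≤m m (v3 j))

-- Below the split, e = d + 2 · 3^m gives v(d) ≤ v(e), and the gain 2d covers the increase of m by
-- one. Above it, j + e = 2 · 3^m gives v(j) = v(e). At i = 3^m itself v(e) is already large enough.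
w-codegree : ∀ m i e → 0 < e → i + e ≡ 3 ^ m → m ≤ suc (w m i + v3 e)
w-codegree zero    i e 0<e eq = z≤n
w-codegree (suc m) i e@(suc e') 0<e eq with compare-sum i (3 ^ m)
... | inj₁ (zero , i+d≡X) = s≤s (≤-trans (≤-reflexive (sym v3e)) (m≤n+m (v3 e) (w (suc m) i)))
  where
  i≡X : i ≡ 3 ^ m
  i≡X = trans (sym (+-identityʳ i)) i+d≡X
  v3e : v3 e ≡ m
  v3e = trans (cong v3 (+-cancelˡ-≡ (3 ^ m) e (2 * 3 ^ m) (trans (cong (_+ e) (sym i≡X)) eq))) (v3-2*3^ m)
... | inj₁ (d@(suc d') , i+d≡X) = s≤s (subst (λ z → m ≤ z + v3 e) (sym (w-low m i d i+d≡X))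
    (≤-trans (w-codegree m i d (s≤s z≤n) i+d≡X)
    (≤-trans (s≤s (+-monoʳ-≤ (w m i) v3d≤))
      (lin≤ (suc (w m i + v3 e)) (w m i + 2 * d + v3 e) (suc (d' + d')) (z≤n {0}) (lemma (w m i) (v3 e) d')))))
  where
  lemma : ∀ w v d → suc (w + v) + 0 + suc (d + d) ≡ w + 2 * suc d + v + 0
  lemma = ℕSolver.solve-∀
  X = 3 ^ m
  e≡ : e ≡ d + 2 * X
  e≡ = +-cancelˡ-≡ i e (d + 2 * X) (trans eq (trans (cong (_+ 2 * X) (sym i+d≡X)) (+-assoc i d (2 * X))))
  v3d≤ : v3 d ≤ v3 e
  v3d≤ = 3^∣⇒≤v3 (v3 d) e (subst (3 ^ v3 d ℕ∣.∣_) (sym e≡) (ℕ∣.∣m∣n⇒∣m+n (3^v3∣ d)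
    (ℕ∣.∣n⇒∣m*n 2 (∣⇒∣ᵤ (3^-∣ {v3 d} {m} (≤-pred (<3^⇒v3< (suc m) d (≤-trans (s≤s (m+n≤o⇒n≤o i (≤-reflexive i+d≡X)))
      (^-monoʳ-< 3 (s≤s (s≤s z≤n)) {m} {suc m} ≤-refl)))))))))
... | inj₂ (j@(suc j') , refl , 0<j) = s≤s (subst (λ z → m ≤ z + v3 e) (sym (w-high m j 0<j))
    (≤-trans (m≤n+m∸n m (v3 j)) (≤-trans (≤-reflexive (+-comm (v3 j) (m ∸ v3 j)))
      (+-monoʳ-≤ (m ∸ v3 j) (≤-reflexive (v3-symmetric m j' e' (+-cancelˡ-≡ (3 ^ m) _ _ (trans (sym (+-assoc (3 ^ m) j e)) eq))))))))

-- The inequality by which the term of index a + e beats the one of index a when the former is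
-- paired with the constant term of U. Above the split it follows crudely from w ≤ m and v(e) < e;
-- below it, by induction on the level.
w-growth : ∀ m a e → 0 < a → 0 < e → a + e ≤ 3 ^ m → suc (w m (a + e) + v3 e) ≤ w m a + 2 * e + m
w-growth zero (suc a) (suc e) 0<a 0<e (s≤s ≤0) = ⊥-elim (<⇒≱ (s≤s z≤n) (m+n≤o⇒n≤o a ≤0))
w-growth (suc m) a e@(suc e') 0<a 0<e a+e≤ with compare-sum (a + e) (3 ^ m)
... | inj₁ (d , eq) = subst₂ (λ x y → suc (x + v3 e) ≤ y + 2 * e + suc m)
    (sym (w-low m (a + e) d eq)) (sym (w-low m a (e + d) (trans (sym (+-assoc a e d)) eq)))
    (lin≤ _ _ (suc (2 * e)) (w-growth m a e 0<a 0<e (subst (a + e ≤_) eq (m≤m+n (a + e) d)))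
      (lemma (w m (a + e)) (v3 e) (w m a) e m d))
  where
  lemma : ∀ x v y e m d → suc (x + 2 * d + v) + (y + 2 * e + m) + suc (2 * e) ≡
          (y + 2 * (e + d) + 2 * e + suc m) + suc (x + v)
  lemma = ℕSolver.solve-∀
... | inj₂ (j , eq , 0<j) = lin≤ _ _ (w (suc m) a + suc (suc e'))
    (+-mono-≤ (w-high-≤ m (a + e) (subst (3 ^ m ≤_) (sym eq) (m≤m+n (3 ^ m) j))) (v3≤ e'))
    (lemma (w (suc m) (a + e)) (v3 e) (w (suc m) a) e' m)
  where
  lemma : ∀ x v y e m → suc (x + v) + (m + e) + (y + suc (suc e)) ≡ y + 2 * suc e + suc m + (x + v)
  lemma = ℕSolver.solve-∀

-- Below the split each level adds 2 to the drop of `w` from i to i + 1, matching the growth of 2m.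
-- Above it, the bound of `w-high-≤` on w at i suffices.
w-step : ∀ m i → 0 < i → suc i ≤ 3 ^ m → w m i + 2 ≤ w m (suc i) + 2 * m
w-step zero (suc i) 0<i (s≤s ())
w-step (suc m) i 0<i i< with compare-sum (suc i) (3 ^ m)
... | inj₁ (d , eq) = subst₂ (λ x y → x + 2 ≤ y + 2 * suc m)
    (sym (w-low m i (suc d) (trans (+-suc i d) eq))) (sym (w-low m (suc i) d eq))
    (lin≤ _ _ 0 (w-step m i 0<i (subst (suc i ≤_) eq (m≤m+n (suc i) d))) (lemma (w m i) (w m (suc i)) d m))
  where
  lemma : ∀ x y d m → x + 2 * suc d + 2 + (y + 2 * m) + 0 ≡ y + 2 * d + 2 * suc m + (x + 2)
  lemma = ℕSolver.solve-∀
... | inj₂ (j , eq , 0<j) = lin≤ _ _ (w (suc m) (suc i) + m)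
    (w-high-≤ m i (≤-pred (≤-trans (≤-trans (≤-reflexive (+-comm 1 (3 ^ m))) (+-monoʳ-≤ (3 ^ m) 0<j)) (≤-reflexive (sym eq)))))
    (lemma (w (suc m) i) (w (suc m) (suc i)) m)
  where
  lemma : ∀ x y m → x + 2 + m + (y + m) ≡ y + 2 * suc m + x
  lemma = ℕSolver.solve-∀

w-steps : ∀ m e i → 0 < i → i + e ≤ 3 ^ m → w m i + e * 2 ≤ w m (i + e) + e * (2 * m)
w-steps m zero i 0<i i≤ = ≤-reflexive (cong (λ z → w m z + 0) (sym (+-identityʳ i)))
w-steps m (suc e) i 0<i i≤ = lin≤ _ _ 0
  (+-mono-≤ (w-step m i 0<i (m+n≤o⇒m≤o (suc i) i+e≤)) (w-steps m e (suc i) (s≤s z≤n) i+e≤))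
  (trans (lemma (w m i) (w m (suc i)) (w m (suc i + e)) e m)
    (cong (λ z → w m z + suc e * (2 * m) + (w m i + 2 + (w m (suc i) + e * 2))) (sym (+-suc i e))))
  where
  i+e≤ : suc i + e ≤ 3 ^ m
  i+e≤ = subst (_≤ 3 ^ m) (+-suc i e) i≤
  lemma : ∀ x y z e m → x + suc e * 2 + (y + 2 * m + (z + e * (2 * m))) + 0 ≡
          z + suc e * (2 * m) + (x + 2 + (y + e * 2))
  lemma = ℕSolver.solve-∀

p : ℕ → ℕ → ℤ
p m = mulLins (roots sq (3 ^ m)) one

mulLins-roots-0 : ∀ n → mulLins (roots sq (suc n)) one 0 ≡ + 0
mulLins-roots-0 zero    = refl
mulLins-roots-0 (suc n) = trans (cong (λ x → ⊝ (sq (suc n) ⊗ x)) (mulLins-roots-0 n)) (cong ⊝_ (ℤ.*-zeroʳ (sq (suc n))))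

p-0 : ∀ m → p m 0 ≡ + 0
p-0 m with 3 ^ m | m^n>0 3 m
... | suc q | _ = mulLins-roots-0 q

scaled : ℕ → ℕ → ℤ
scaled m = mulLins (map (+ 9 ⊗_) (roots sq (3 ^ m))) one

p-suc : ∀ m i → p (suc m) i ≡ dot (suc i) (scaled m) (λ a → unitFactor m (i ∸ a))
p-suc m i = begin
  mulLins (roots sq (3 * X)) one i                       ≡⟨ cong (λ n → mulLins (roots sq n) one i) (*-comm 3 X) ⟩
  mulLins (roots sq (X * 3)) one i                       ≡⟨ mulLins-↭ (squareRoots-split X) one i ⟩
  mulLins (map (+ 9 ⊗_) (roots sq X) ++ rest) one i      ≡⟨ cong (λ h → h i) (mulLins-++ (map (+ 9 ⊗_) (roots sq X)) rest one) ⟩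
  mulLins (map (+ 9 ⊗_) (roots sq X)) (unitFactor m) i   ≡⟨ mulLins-convolution (map (+ 9 ⊗_) (roots sq X)) (unitFactor m) i ⟩
  dot (suc i) (scaled m) (λ a → unitFactor m (i ∸ a))    ∎
  where
  open ≡-Reasoning
  X = 3 ^ m
  rest = residueRoots 1 X ++ residueRoots 2 X

scaled-≡ : ∀ m a b → a + b ≡ 3 ^ m → scaled m a ≡ (+ 9) ⊗^ b ⊗ p m a
scaled-≡ m a b eq = mulLins-scale (+ 9) (roots sq (3 ^ m)) a b (trans (length-roots sq (3 ^ m)) (sym eq))

scaled-0 : ∀ m → scaled m 0 ≡ + 0
scaled-0 m = trans (scaled-≡ m 0 (3 ^ m) refl) (trans (cong (((+ 9) ⊗^ (3 ^ m)) ⊗_) (p-0 m)) (ℤ.*-zeroʳ ((+ 9) ⊗^ (3 ^ m))))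

scaled-degree : ∀ m a → 3 ^ m < a → scaled m a ≡ + 0
scaled-degree m a X<a = mulLins-degree (map (+ 9 ⊗_) (roots sq (3 ^ m))) a
  (subst (_< a) (sym (trans (length-map (+ 9 ⊗_) (roots sq (3 ^ m))) (length-roots sq (3 ^ m)))) X<a)

Val-⊗^ : ∀ {v x} b → Val v x → Val (b * v) (x ⊗^ b)
Val-⊗^ zero    h = Val-1
Val-⊗^ (suc b) h = Val-* h (Val-⊗^ b h)

Val-9 : Val 2 (+ 9)
Val-9 = Val-* {1} {1} Val-3 Val-3
  where
  Val-3 : Val 1 (+ 3)
  Val-3 = v3-Val 3

≡0⇒∣ : ∀ {d x} → x ≡ + 0 → d ∣ x
≡0⇒∣ refl = divides (+ 0) refl

Val-p : ∀ m i → 0 < i → i ≤ 3 ^ m → Val (w m i) (p m i)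
Val-p zero (suc zero) 0<i i≤ = Val-1
Val-p zero (suc (suc i)) 0<i (s≤s ())
Val-p (suc m) i 0<i i≤ = subst (Val (w (suc m) i)) (sym (p-suc m i)) (cases (compare-sum i X))
  where
  X = 3 ^ m
  U = unitFactor m
  Val-scaled : ∀ a b → 0 < a → a + b ≡ X → Val (b * 2 + w m a) (scaled m a)
  Val-scaled a b 0<a eq = subst (Val (b * 2 + w m a)) (sym (scaled-≡ m a b eq))
    (Val-* (Val-⊗^ b Val-9) (Val-p m a 0<a (subst (a ≤_) eq (m≤m+n a b))))
  term-∣ : ∀ {k} a b e → 0 < a → a + b ≡ X → 0 < e → k ≤ b * 2 + w m a + (m ∸ v3 e) → + (3 ^ k) ∣ scaled m a ⊗ U e
  term-∣ a b (suc e) 0<a eq 0<e k≤ = ∣-trans (3^-∣ k≤)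
    (3^-∣-* {b * 2 + w m a} {m ∸ v3 (suc e)} (Val⇒∣ (Val-scaled a b 0<a eq)) (unitFactor-∣ m e))
  zero-∣ : ∀ {d} a y → scaled m a ≡ + 0 → d ∣ scaled m a ⊗ y
  zero-∣ a y eq = ≡0⇒∣ (trans (cong (_⊗ y) eq) (ℤ.*-zeroˡ y))
  cases : (∃ λ d → i + d ≡ X) ⊎ (∃ λ j → i ≡ X + j × 0 < j) →
          Val (w (suc m) i) (dot (suc i) (scaled m) (λ a → U (i ∸ a)))
  cases (inj₁ (d , eq)) = subst (λ v → Val v (dot (suc i) (scaled m) (λ a → U (i ∸ a)))) (sym (w-low m i d eq))
    (Val-dot (suc i) (scaled m) (λ a → U (i ∸ a)) i ≤-refl main others)
    where
    main : Val (w m i + 2 * d) (scaled m i ⊗ U (i ∸ i))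
    main = subst₂ (λ v e → Val v (scaled m i ⊗ U e)) (lemma d (w m i)) (sym (n∸n≡0 i))
      (Val-* (Val-scaled i d 0<i eq) (Val-unitFactor-0 m))
      where
      lemma : ∀ d w → d * 2 + w + 0 ≡ w + 2 * d
      lemma = ℕSolver.solve-∀
    others : ∀ a → a < suc i → a ≢ i → + (3 ^ suc (w m i + 2 * d)) ∣ scaled m a ⊗ U (i ∸ a)
    others zero a< a≢ = zero-∣ 0 (U i) (scaled-0 m)
    others a@(suc _) a< a≢ = term-∣ {suc (w m i + 2 * d)} a (e + d) e (s≤s z≤n) (trans (sym (+-assoc a e d)) (trans (cong (_+ d) a+e) eq)) 0<e
      (lin≤ _ _ 0 (≤-trans growth (+-monoʳ-≤ (w m a + 2 * e) (m≤n+m∸n m (v3 e))))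
        (lemma (w m i) d (w m a) e (v3 e) (m ∸ v3 e)))
      where
      a<i = ≤∧≢⇒< (≤-pred a<) a≢
      e = i ∸ a
      0<e : 0 < e
      0<e = m<n⇒0<n∸m a<i
      a+e : a + e ≡ i
      a+e = m+[n∸m]≡n (<⇒≤ a<i)
      growth : suc (w m i + v3 e) ≤ w m a + 2 * e + m
      growth = subst (λ z → suc (w m z + v3 e) ≤ w m a + 2 * e + m) a+e
        (w-growth m a e (s≤s z≤n) 0<e (subst (_≤ X) (sym a+e) (subst (i ≤_) eq (m≤m+n i d))))
      lemma : ∀ x d y e v r → suc (x + 2 * d) + (y + 2 * e + (v + r)) + 0 ≡ (e + d) * 2 + y + r + suc (x + v)
      lemma = ℕSolver.solve-∀
  cases (inj₂ (j@(suc j') , refl , 0<j)) = subst (λ v → Val v (dot (suc i) (scaled m) (λ a → U (i ∸ a)))) (sym (w-high m j 0<j))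
    (Val-dot (suc i) (scaled m) (λ a → U (i ∸ a)) X (s≤s (m≤m+n X j)) main others)
    where
    main : Val (m ∸ v3 j) (scaled m X ⊗ U (X + j ∸ X))
    main = subst₂ (λ v e → Val (v + (m ∸ v3 j)) (scaled m X ⊗ U e)) (w-top m) (sym (m+n∸m≡n X j))
      (Val-* (Val-scaled X 0 (m^n>0 3 m) (+-identityʳ X)) (Val-unitFactor m j' (+-cancelˡ-≤ X j (2 * X) i≤)))
    others : ∀ a → a < suc i → a ≢ X → + (3 ^ suc (m ∸ v3 j)) ∣ scaled m a ⊗ U (i ∸ a)
    others zero a< a≢ = zero-∣ 0 (U i) (scaled-0 m)
    others a@(suc _) a< a≢ with compare-sum a X
    ... | inj₂ (b , eq , 0<b) = zero-∣ a (U (i ∸ a)) (scaled-degree m a (subst (X <_) (sym eq) (m<m+n X 0<b)))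
    ... | inj₁ (zero , eq) = ⊥-elim (a≢ (trans (sym (+-identityʳ a)) eq))
    ... | inj₁ (e@(suc e') , eq) = subst (λ z → + (3 ^ suc (m ∸ v3 j)) ∣ scaled m a ⊗ U z) (sym i∸a)
        (term-∣ a e (e + j) (s≤s z≤n) eq (s≤s z≤n) bound)
      where
      i∸a : X + j ∸ a ≡ e + j
      i∸a = trans (cong (_∸ a) (trans (cong (_+ j) (sym eq)) (+-assoc a e j))) (m+n∸m≡n a (e + j))
      -- If v(e + j) ≤ v(j), the factor 9^e alone suffices. Otherwise v(e) ≤ v(j), since a higher
      -- power of 3 dividing e and e + j would divide j; then `w-codegree` bounds m - v(j) by 1 + w
      -- m a, and e ≥ 1 supplies the missing unit.
      bound : suc (m ∸ v3 j) ≤ e * 2 + w m a + (m ∸ v3 (e + j))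
      bound with v3 (e + j) ≤? v3 j
      ... | yes v≤ = s≤s (≤-trans (∸-monoʳ-≤ m v≤) (m≤n+m (m ∸ v3 (e + j)) (suc (e' * 2) + w m a)))
      ... | no  v≰ = s≤s (≤-trans (m≤n+o⇒m∸n≤o m (v3 j) codegree) (s≤s (≤-trans (m≤n+m (w m a) (e' * 2)) (m≤m+n _ _))))
        where
        v3e≤v3j : v3 e ≤ v3 j
        v3e≤v3j with v3 e ≤? v3 j
        ... | yes q = q
        ... | no ¬q = ⊥-elim (<⇒≱ ≤-refl (3^∣⇒≤v3 (suc (v3 j)) j (ℕ∣.∣m+n∣m⇒∣n
                (ℕ∣.∣-trans (∣⇒∣ᵤ (3^-∣ (≰⇒> v≰))) (3^v3∣ (e + j)))
                (ℕ∣.∣-trans (∣⇒∣ᵤ (3^-∣ (≰⇒> ¬q))) (3^v3∣ e)))))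
        codegree : m ≤ v3 j + suc (w m a)
        codegree = ≤-trans (w-codegree m a e (s≤s z≤n) eq)
          (≤-trans (s≤s (+-monoʳ-≤ (w m a) v3e≤v3j)) (≤-reflexive (+-comm (suc (w m a)) (v3 j))))

-- Stirling numbers

-- The Stirling recurrence is multiplication of the rising factorial by its next factor; the factor
-- x is divided out, which lowers the index k by one.
stirling1-mulLins : ∀ n k → + stirling1 (suc n) (suc k) ≡ mulLins (roots (λ j → ⊝ (+ suc j)) n) one k
stirling1-mulLins zero    zero    = refl
stirling1-mulLins zero    (suc k) = refl
stirling1-mulLins (suc n) zero    = trans (cong +_ (+-identityʳ (suc n * stirling1 (suc n) 1)))
  (trans (ℤ.pos-* (suc n) (stirling1 (suc n) 1)) (trans (lemma (+ suc n) (+ stirling1 (suc n) 1))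
    (cong (λ x → ⊝ (⊝ (+ suc n) ⊗ x)) (stirling1-mulLins n 0))))
  where
  lemma : ∀ c x → c ⊗ x ≡ ⊝ (⊝ c ⊗ x)
  lemma = ℤSolver.solve-∀
stirling1-mulLins (suc n) (suc k) = trans
  (cong (_⊕ + stirling1 (suc n) (suc k)) (ℤ.pos-* (suc n) (stirling1 (suc n) (suc (suc k)))))
  (trans (lemma (+ suc n) (+ stirling1 (suc n) (suc (suc k))) (+ stirling1 (suc n) (suc k)))
    (cong₂ (λ x y → x ⊕ ⊝ (⊝ (+ suc n) ⊗ y)) (stirling1-mulLins n k) (stirling1-mulLins n (suc k))))
  where
  lemma : ∀ c x y → c ⊗ x ⊕ y ≡ y ⊕ ⊝ (⊝ c ⊗ x)
  lemma = ℤSolver.solve-∀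

roots-suc : ∀ c n → roots c (suc n) ↭ c 0 ∷ roots (c ∘ suc) n
roots-suc c zero    = ↭-refl
roots-suc c (suc n) = ↭-trans (prep (c (suc n)) (roots-suc c n)) (swap (c (suc n)) (c 0) ↭-refl)

-- Opposite roots c + j and c - j stand side by side so that each pair merges into (x - c)² - j².
centredRoots : ℤ → ℕ → List ℤ
centredRoots c zero    = c ∷ []
centredRoots c (suc d) = c ⊕ + suc d ∷ c ⊕ ⊝ (+ suc d) ∷ centredRoots c d

-- Both ends of the window of 2d + 1 consecutive integers are peeled off at once, leaving the window
-- for the next smaller radius.
centredRoots-↭ : ∀ c d → roots (λ t → c ⊕ + d ⊕ ⊝ (+ t)) (suc (d + d)) ↭ centredRoots c d
centredRoots-↭ c zero    = subst (λ x → x ∷ [] ↭ c ∷ []) (sym (lemma c)) ↭-refl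
  where
  lemma : ∀ c → c ⊕ + 0 ⊕ ⊝ (+ 0) ≡ c
  lemma = ℤSolver.solve-∀
centredRoots-↭ c (suc d) = subst (λ n → roots window (suc (suc n)) ↭ centredRoots c (suc d)) (sym (+-suc d d))
  (↭-trans (prep _ (roots-suc window (suc (d + d))))
  (subst₂ (λ x y → x ∷ y ∷ roots (window ∘ suc) (suc (d + d)) ↭ centredRoots c (suc d))
    (sym (low c (+ d))) (sym (high c (+ suc d)))
    (swap _ _ (subst (_↭ centredRoots c d) (sym (roots-cong (λ t → inner c (+ d) (+ t)) (suc (d + d)))) (centredRoots-↭ c d)))))
  where
  window : ℕ → ℤ
  window t = c ⊕ + suc d ⊕ ⊝ (+ t)
  low : ∀ c d → c ⊕ (+ 1 ⊕ d) ⊕ ⊝ (+ 2 ⊕ (d ⊕ d)) ≡ c ⊕ ⊝ (+ 1 ⊕ d)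
  low = ℤSolver.solve-∀
  high : ∀ c d → c ⊕ d ⊕ ⊝ (+ 0) ≡ c ⊕ d
  high = ℤSolver.solve-∀
  inner : ∀ c d t → c ⊕ (+ 1 ⊕ d) ⊕ ⊝ (+ 1 ⊕ t) ≡ c ⊕ d ⊕ ⊝ t
  inner = ℤSolver.solve-∀

dot-mulLinʳ : ∀ n c (g : ℕ → ℤ) (h : ℕ → ℕ → ℤ) k → mulLin c (λ k → dot n g (λ l → h l k)) k ≡ dot n g (λ l → mulLin c (h l) k)
dot-mulLinʳ zero c g h zero    = cong ⊝_ (ℤ.*-zeroʳ c)
dot-mulLinʳ zero c g h (suc k) = trans (ℤ.+-identityˡ _) (cong ⊝_ (ℤ.*-zeroʳ c))
dot-mulLinʳ (suc n) c g h k = begin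
  mulLin c (λ k → g 0 ⊗ h 0 k ⊕ d k) k                    ≡⟨ mulLin-cong c (λ k → ℤ.+-comm (g 0 ⊗ h 0 k) (d k)) k ⟩
  mulLin c (λ k → d k ⊕ g 0 ⊗ h 0 k) k                    ≡⟨ mulLin-linear c (g 0) d (h 0) k ⟩
  mulLin c d k ⊕ g 0 ⊗ mulLin c (h 0) k                   ≡⟨ ℤ.+-comm (mulLin c d k) (g 0 ⊗ mulLin c (h 0) k) ⟩
  g 0 ⊗ mulLin c (h 0) k ⊕ mulLin c d k                   ≡⟨ cong (λ x → g 0 ⊗ mulLin c (h 0) k ⊕ x) (dot-mulLinʳ n c (g ∘ suc) (h ∘ suc) k) ⟩
  g 0 ⊗ mulLin c (h 0) k ⊕ dot n (g ∘ suc) (λ l → mulLin c (h (suc l)) k) ∎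
  where
  open ≡-Reasoning
  d : ℕ → ℤ
  d k = dot n (g ∘ suc) (λ l → h (suc l) k)

dot-drop-last : ∀ n f g → f n ≡ + 0 → dot (suc n) f g ≡ dot n f g
dot-drop-last zero    f g eq = trans (ℤ.+-identityʳ _) (trans (cong (_⊗ g 0) eq) (ℤ.*-zeroˡ (g 0)))
dot-drop-last (suc n) f g eq = cong (λ x → f 0 ⊗ g 0 ⊕ x) (dot-drop-last n (f ∘ suc) (g ∘ suc) eq)

dot-congˡ : ∀ n {f f'} g → f ≗ f' → dot n f g ≡ dot n f' g
dot-congˡ zero    g h = refl
dot-congˡ (suc n) g h = cong₂ (λ x y → x ⊗ g 0 ⊕ y) (h 0) (dot-congˡ n (g ∘ suc) (h ∘ suc))

linearPower : ℤ → ℕ → ℕ → ℤ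
linearPower c n = mulLins (replicate n c) one

positiveSquares : ℕ → ℕ → ℤ
positiveSquares d = mulLins (roots (sq ∘ suc) d) one

-- With y = x − c: ∏_{|j| ≤ d} (y − j) = y ∏_{1 ≤ j ≤ d} (y² − j²) has only odd powers of y.
centredRoots-expand : ∀ c d k →
  mulLins (centredRoots c d) one k ≡ dot (suc d) (positiveSquares d) (λ l → linearPower c (suc (l * 2)) k)
centredRoots-expand c zero k = lemma (mulLin c one k)
  where
  lemma : ∀ x → x ≡ + 1 ⊗ x ⊕ + 0
  lemma = ℤSolver.solve-∀
centredRoots-expand c (suc d) k = begin
  mulLin (c ⊕ s) (mulLin (c ⊕ ⊝ s) F) k
    ≡⟨ mulLin-pair c s (⊝ s) F k ⟩
  mulLin c (mulLin c F) k ⊕ ((s ⊗ ⊝ s) ⊗ F k ⊕ ⊝ ((s ⊕ ⊝ s) ⊗ mulLin c F k))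
    ≡⟨ simplify (mulLin c (mulLin c F) k) s (F k) (mulLin c F k) ⟩
  mulLin c (mulLin c F) k ⊕ ⊝ (sq (suc d) ⊗ F k)
    -- The second sum is lengthened by the coefficient of G beyond its degree, which is 0, to fit
    -- the ranges of `dot-mulLin`.
    ≡⟨ cong₂ (λ x y → x ⊕ ⊝ (sq (suc d) ⊗ y)) shifted
         (trans (centredRoots-expand c d k) (sym (dot-drop-last (suc d) G (λ l → y l k)
           (mulLins-degree (roots (sq ∘ suc) d) (suc d) (s≤s (≤-reflexive (length-roots (sq ∘ suc) d))))))) ⟩
  dot (suc d) G (λ l → y (suc l) k) ⊕ ⊝ (sq (suc d) ⊗ dot (suc (suc d)) G (λ l → y l k))
    ≡⟨ dot-mulLin (suc d) (sq (suc d)) G (λ l → y l k) ⟨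
  dot (suc (suc d)) (mulLin (sq (suc d)) G) (λ l → y l k) ∎
  where
  open ≡-Reasoning
  s : ℤ
  s = + suc d
  F G : ℕ → ℤ
  F = mulLins (centredRoots c d) one
  G = positiveSquares d
  y : ℕ → ℕ → ℤ
  y l = linearPower c (suc (l * 2))
  simplify : ∀ x s a b → x ⊕ ((s ⊗ ⊝ s) ⊗ a ⊕ ⊝ ((s ⊕ ⊝ s) ⊗ b)) ≡ x ⊕ ⊝ ((s ⊗ s) ⊗ a)
  simplify = ℤSolver.solve-∀
  shifted : mulLin c (mulLin c F) k ≡ dot (suc d) G (λ l → y (suc l) k)
  shifted = trans (mulLin-cong c (λ k → trans (mulLin-cong c (centredRoots-expand c d) k) (dot-mulLinʳ (suc d) c G y k)) k)
    (dot-mulLinʳ (suc d) c G (λ l → mulLin c (y l)) k)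

-- The root 0² of p_n is a factor z, which shifts the coefficients by one.
positiveSquares-p : ∀ n q → 3 ^ n ≡ suc q → positiveSquares q ≗ (λ l → p n (suc l))
positiveSquares-p n q eq l = sym (begin
  mulLins (roots sq (3 ^ n)) one (suc l)    ≡⟨ cong (λ x → mulLins (roots sq x) one (suc l)) eq ⟩
  mulLins (roots sq (suc q)) one (suc l)    ≡⟨ mulLins-↭ (roots-suc sq q) one (suc l) ⟩
  mulLin (+ 0) (positiveSquares q) (suc l)  ≡⟨ lemma (positiveSquares q l) (positiveSquares q (suc l)) ⟩
  positiveSquares q l                       ∎)
  where
  open ≡-Reasoning
  lemma : ∀ x y → x ⊕ ⊝ (+ 0 ⊗ y) ≡ x
  lemma = ℤSolver.solve-∀

stirling1-centred : ∀ q k → + stirling1 (2 * suc q) (suc k) ≡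
  dot (suc q) (positiveSquares q) (λ l → linearPower (⊝ (+ suc q)) (suc (l * 2)) k)
stirling1-centred q k = begin
  + stirling1 (2 * suc q) (suc k)
    ≡⟨ cong (λ x → + stirling1 x (suc k)) (double q) ⟩
  + stirling1 (suc (suc (q + q))) (suc k)
    ≡⟨ stirling1-mulLins (suc (q + q)) k ⟩
  mulLins (roots (λ j → ⊝ (+ suc j)) (suc (q + q))) one k
    ≡⟨ cong (λ cs → mulLins cs one k) (roots-cong (λ j → recentre (+ q) (+ j)) (suc (q + q))) ⟩
  mulLins (roots (λ j → c ⊕ + q ⊕ ⊝ (+ j)) (suc (q + q))) one k
    ≡⟨ mulLins-↭ (centredRoots-↭ c q) one k ⟩
  mulLins (centredRoots c q) one k
    ≡⟨ centredRoots-expand c q k ⟩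
  dot (suc q) (positiveSquares q) (λ l → linearPower c (suc (l * 2)) k) ∎
  where
  open ≡-Reasoning
  c : ℤ
  c = ⊝ (+ suc q)
  double : ∀ q → 2 * suc q ≡ suc (suc (q + q))
  double = ℕSolver.solve-∀
  recentre : ∀ q j → ⊝ (+ 1 ⊕ j) ≡ ⊝ (+ 1 ⊕ q) ⊕ q ⊕ ⊝ j
  recentre = ℤSolver.solve-∀

stirling1-expand : ∀ n k → + stirling1 (2 * 3 ^ n) (suc k) ≡
  dot (3 ^ n) (λ l → p n (suc l)) (λ l → linearPower (⊝ (+ (3 ^ n))) (suc (l * 2)) k)
stirling1-expand n k = subst (λ X → + stirling1 (2 * X) (suc k) ≡
    dot X (λ l → p n (suc l)) (λ l → linearPower (⊝ (+ X)) (suc (l * 2)) k)) 3^n≡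
  (trans (stirling1-centred q k) (dot-congˡ (suc q) (λ l → linearPower (⊝ (+ suc q)) (suc (l * 2)) k)
    (positiveSquares-p n q (sym 3^n≡))))
  where
  q = pred (3 ^ n)
  3^n≡ : suc q ≡ 3 ^ n
  3^n≡ = suc-pred (3 ^ n) {{m^n≢0 3 n}}

Val-linearPower : ∀ n k b N → k + b ≡ N → Val (b * n + v3 (bin k b)) (linearPower (⊝ (+ (3 ^ n))) N k)
Val-linearPower n k b N refl = subst (Val (b * n + v3 (bin k b)))
  (sym (trans (mulLins-replicate (⊝ (+ (3 ^ n))) k b) (cong (λ x → x ⊗^ b ⊗ + bin k b) (ℤ.neg-involutive (+ (3 ^ n))))))
  (Val-* (Val-⊗^ b (val {n} (+ 1) (sym (ℤ.*-identityʳ (+ (3 ^ n)))) (Val.3∤unit Val-1))) (v3-Val (bin k b) {{bin≢0 k b}}))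

linearPower-degree : ∀ c n k → n < k → linearPower c n k ≡ + 0
linearPower-degree c n k n<k = mulLins-degree (replicate n c) k (subst (_< k) (sym (length-replicate n)) n<k)

-- In the expansion of s(2·3ⁿ, k+1) the term l = ⌊k/2⌋ dominates.
Val-stirling1 : ∀ n k t b → t < 3 ^ n → k + b ≡ suc (t * 2) → t * 2 ≤ k →
  (∀ e → t + suc e < 3 ^ n → suc (w n (suc t) + (b * n + v3 (bin k b))) ≤
     w n (suc (t + suc e)) + ((b + suc e * 2) * n + v3 (bin k (b + suc e * 2)))) →
  v3 (stirling1 (2 * 3 ^ n) (suc k)) ≡ w n (suc t) + (b * n + v3 (bin k b))
Val-stirling1 n k t b t< k+b k≥ bound = Val⇒v3 (+ stirling1 (2 * 3 ^ n) (suc k))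
  (subst (Val W) (sym (stirling1-expand n k))
    (Val-dot (3 ^ n) f g t t< (Val-* (Val-p n (suc t) (s≤s z≤n) t<) (Val-linearPower n k b (suc (t * 2)) k+b)) others))
  where
  f g : ℕ → ℤ
  f l = p n (suc l)
  g l = linearPower (⊝ (+ (3 ^ n))) (suc (l * 2)) k
  W = w n (suc t) + (b * n + v3 (bin k b))
  others : ∀ a → a < 3 ^ n → a ≢ t → + (3 ^ suc W) ∣ f a ⊗ g a
  others a a< a≢ with compare-sum t a
  ... | inj₁ (zero , eq) = ⊥-elim (a≢ (trans (sym eq) (+-identityʳ t)))
  ... | inj₁ (suc e , refl) = Val⇒∣′ (bound e a<)
    (Val-* (Val-p n (suc a) (s≤s z≤n) a<) (Val-linearPower n k (b + suc e * 2) (suc (a * 2)) index))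
    where
    Val⇒∣′ : ∀ {v v' x} → v ≤ v' → Val v' x → + (3 ^ v) ∣ x
    Val⇒∣′ v≤ h = ∣-trans (3^-∣ v≤) (Val⇒∣ h)
    lemma : ∀ t e → suc (t * 2) + suc e * 2 ≡ suc ((t + suc e) * 2)
    lemma = ℕSolver.solve-∀
    index : k + (b + suc e * 2) ≡ suc (a * 2)
    index = trans (sym (+-assoc k b (suc e * 2))) (trans (cong (_+ suc e * 2) k+b) (lemma t e))
  -- For a < t the power has degree 2a + 1 < 2t ≤ k, so it has no coefficient at k.
  ... | inj₂ (suc e , refl , _) = ≡0⇒∣ (trans (cong (f a ⊗_) (linearPower-degree (⊝ (+ (3 ^ n))) (suc (a * 2)) k
          (≤-trans (m≤m+n (suc (suc (a * 2))) (e * 2)) (≤-trans (≤-reflexive (lemma a e)) k≥)))) (ℤ.*-zeroʳ (f a)))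
    where
    lemma : ∀ a e → suc (suc (a * 2)) + e * 2 ≡ (a + suc e) * 2
    lemma = ℕSolver.solve-∀

bin-1ʳ : ∀ a → bin a 1 ≡ suc a
bin-1ʳ zero    = refl
bin-1ʳ (suc a) = trans (+-comm (bin a 1) 1) (cong suc (bin-1ʳ a))

v3-odd : ∀ e → v3 (suc (e * 2)) ≤ e
v3-odd e = ≤-pred (<3^⇒v3< (suc e) (suc (e * 2)) (odd<3^ e))
  where
  lemma : ∀ e x → suc (suc (suc e * 2)) + 3 * x + suc (suc (e * 4)) ≡ 3 * x + 3 * suc (suc (e * 2))
  lemma = ℕSolver.solve-∀
  odd<3^ : ∀ e → suc (e * 2) < 3 ^ suc e
  odd<3^ zero    = s≤s (s≤s z≤n)
  odd<3^ (suc e) = lin≤ _ _ (suc (suc (e * 4))) (*-monoʳ-≤ 3 (odd<3^ e)) (lemma e (3 ^ suc e))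

-- The term l = t contributes 3^n (2t + 1). Moving to l = t + E gains 2nE from the power of 3^n,
-- loses at most (2n - 2)E in `w`, and at most v(2E + 1) ≤ E in the binomial coefficient; a surplus
-- of at least E remains.
v3-stirling1-odd : ∀ n t → t < 3 ^ n → v3 (stirling1 (2 * 3 ^ n) (suc (t * 2))) ≡ w n (suc t) + (n + v3 (suc (t * 2)))
v3-stirling1-odd n t t< = trans (Val-stirling1 n (t * 2) t 1 t< (+-comm (t * 2) 1) ≤-refl bound)
  (cong₂ (λ x y → w n (suc t) + (x + v3 y)) (+-identityʳ n) (bin-1ʳ (t * 2)))
  where
  bound : ∀ e → t + suc e < 3 ^ n → suc (w n (suc t) + (1 * n + v3 (bin (t * 2) 1))) ≤
          w n (suc (t + suc e)) + ((1 + suc e * 2) * n + v3 (bin (t * 2) (1 + suc e * 2)))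
  bound e t+e< = subst (λ z → suc (w n (suc t) + (1 * n + v3 z)) ≤ w n (suc (t + E)) + ((1 + E * 2) * n + B)) (sym (bin-1ʳ (t * 2)))
    (lin≤ _ _ e (+-mono-≤ (w-steps n E (suc t) (s≤s z≤n) t+e<) (≤-trans absorbed (+-monoˡ-≤ B (v3-odd E))))
      (lemma (w n (suc t)) (w n (suc (t + E))) n e (v3 (suc (t * 2))) B))
    where
    E = suc e
    B = v3 (bin (t * 2) (suc (E * 2)))
    absorbed : v3 (suc (t * 2)) ≤ v3 (suc (E * 2)) + B
    absorbed = begin
      v3 (suc (t * 2))                                              ≤⟨ m≤m+n _ _ ⟩
      v3 (suc (t * 2)) + v3 (bin (suc (t * 2)) (E * 2))             ≡⟨ v3-* (suc (t * 2)) (bin (suc (t * 2)) (E * 2)) {{_}} {{bin≢0 (suc (t * 2)) (E * 2)}} ⟨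
      v3 (suc (t * 2) * bin (suc (t * 2)) (E * 2))                  ≡⟨ cong v3 (bin-exchange (t * 2) (E * 2)) ⟩
      v3 (suc (E * 2) * bin (t * 2) (suc (E * 2)))                  ≡⟨ v3-* (suc (E * 2)) (bin (t * 2) (suc (E * 2))) {{_}} {{bin≢0 (t * 2) (suc (E * 2))}} ⟩
      v3 (suc (E * 2)) + B                                          ∎
      where open ≤-Reasoning
    lemma : ∀ x y n e v b → suc (x + (1 * n + v)) + ((y + suc e * (2 * n)) + (suc e + b)) + e ≡
            y + ((1 + suc e * 2) * n + b) + (x + suc e * 2 + v)
    lemma = ℕSolver.solve-∀

-- Here the term l = t meets the leading coefficient 1 of its power of y, so `w-steps` alone gives
-- dominance.
v3-stirling1-even : ∀ n t → t < 3 ^ n → v3 (stirling1 (2 * 3 ^ n) (suc (suc (t * 2)))) ≡ w n (suc t)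
v3-stirling1-even n t t< = trans (Val-stirling1 n (suc (t * 2)) t 0 t< (+-identityʳ _) (n≤1+n _) bound)
  (+-identityʳ (w n (suc t)))
  where
  bound : ∀ e → t + suc e < 3 ^ n → suc (w n (suc t) + 0) ≤
          w n (suc (t + suc e)) + (suc e * 2 * n + v3 (bin (suc (t * 2)) (suc e * 2)))
  bound e t+e< = lin≤ _ _ (suc (e * 2) + v3 (bin (suc (t * 2)) (suc e * 2))) (w-steps n (suc e) (suc t) (s≤s z≤n) t+e<)
    (lemma (w n (suc t)) (w n (suc (t + suc e))) n e (v3 (bin (suc (t * 2)) (suc e * 2))))
    where
    lemma : ∀ x y n e v → suc (x + 0) + (y + suc e * (2 * n)) + (suc (e * 2) + v) ≡
            y + (suc e * 2 * n + v) + (x + suc e * 2)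
    lemma = ℕSolver.solve-∀

-- Comparison with the valuation at k = 1

-- The level increments 2(3^m - 1) telescope. Adding n for the power of Q yields the value 3^n - n -
-- 1.
w-1 : ∀ m → w (suc m) 1 + (2 * suc m + 1) ≡ 3 ^ suc m
w-1 zero    = refl
w-1 (suc m) = begin
  w (suc (suc m)) 1 + (2 * suc (suc m) + 1)          ≡⟨ cong (_+ (2 * suc (suc m) + 1)) (w-low (suc m) 1 q suc-q) ⟩
  w (suc m) 1 + 2 * q + (2 * suc (suc m) + 1)        ≡⟨ lemma (w (suc m) 1) q m ⟩
  w (suc m) 1 + (2 * suc m + 1) + 2 * suc q          ≡⟨ cong₂ (λ x y → x + 2 * y) (w-1 m) suc-q ⟩
  3 ^ suc m + 2 * 3 ^ suc m                          ∎
  where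
  open ≡-Reasoning
  q = pred (3 ^ suc m)
  suc-q : suc q ≡ 3 ^ suc m
  suc-q = suc-pred (3 ^ suc m) {{m^n≢0 3 (suc m)}}
  lemma : ∀ x q m → x + 2 * q + (2 * suc (suc m) + 1) ≡ x + (2 * suc m + 1) + 2 * suc q
  lemma = ℕSolver.solve-∀

-- The left side collects (2 + m) + (3 + m) + (2(3 + m) + 1): the bounds for `w` and v(2t + 1) above
-- the split, and the constant in `w-bound`.
4m+12≤3^ : ∀ m → 4 * m + 12 ≤ 3 ^ (3 + m)
4m+12≤3^ zero    = toWitness {a? = 12 ≤? 27} _
4m+12≤3^ (suc m) = lin≤ _ _ (8 * m + 20) (*-monoʳ-≤ 3 (4m+12≤3^ m)) (lemma m (3 ^ (3 + m)))
  where
  lemma : ∀ m x → 4 * suc m + 12 + 3 * x + (8 * m + 20) ≡ 3 * x + 3 * (4 * m + 12)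
  lemma = ℕSolver.solve-∀

-- By w-1 this says that the valuation of s(2·3ⁿ, 2t+1) is maximal at t = 0.
w-bound : ∀ m t → t < 3 ^ (2 + m) → w (2 + m) (suc t) + v3 (suc (t * 2)) + (2 * (2 + m) + 1) ≤ 3 ^ (2 + m)
-- The induction starts at n = 2, by evaluation: for n = 1 the inequality fails at t = 1, in
-- accordance with the exceptional maximum at s(6, 3).
w-bound zero t t< = toWitness {a? = allUpTo? (λ t → w 2 (suc t) + v3 (suc (t * 2)) + 5 ≤? 9) 9} _ t<
w-bound (suc m) t t< with compare-sum (suc t) (3 ^ (2 + m))
-- The next level adds 2d + 2 on the left and 2(t + 1 + d) on the right; the slack is the difference
-- 2t.
... | inj₁ (d , eq) = subst (λ z → z + v3 (suc (t * 2)) + (2 * (3 + m) + 1) ≤ 3 ^ (3 + m)) (sym (w-low (2 + m) (suc t) d eq))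
    (lin≤ _ _ (2 * t) (w-bound m t (subst (suc t ≤_) eq (m≤m+n (suc t) d)))
      (trans (lemma (w (2 + m) (suc t)) (v3 (suc (t * 2))) t m (3 ^ (2 + m)) d)
        (cong (λ x → 3 ^ (2 + m) + 2 * x + (w (2 + m) (suc t) + v3 (suc (t * 2)) + (2 * (2 + m) + 1))) eq)))
  where
  lemma : ∀ x v t m X d → x + 2 * d + v + (2 * (3 + m) + 1) + X + 2 * t ≡ X + 2 * (suc t + d) + (x + v + (2 * (2 + m) + 1))
  lemma = ℕSolver.solve-∀
... | inj₂ (j , eq , 0<j) = lin≤ _ _ 0
    (+-mono-≤ (+-mono-≤ (w-high-≤ (2 + m) (suc t) (subst (3 ^ (2 + m) ≤_) (sym eq) (m≤m+n _ j))) v3≤3+m) (4m+12≤3^ m))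
    (lemma (w (3 + m) (suc t)) (v3 (suc (t * 2))) m (3 ^ (3 + m)))
  where
  double : ∀ t → suc (suc (t * 2)) ≡ 2 * suc t
  double = ℕSolver.solve-∀
  v3≤3+m : v3 (suc (t * 2)) ≤ 3 + m
  v3≤3+m = ≤-pred (<3^⇒v3< (4 + m) (suc (t * 2)) (≤-trans (≤-reflexive (double t)) (≤-trans (*-monoʳ-≤ 2 t<)
    (*-monoˡ-≤ (3 ^ (3 + m)) {2} {3} (s≤s (s≤s z≤n))))))
  lemma : ∀ x v m X → x + v + (2 * (3 + m) + 1) + ((2 + m) + (3 + m) + X) + 0 ≡ X + (x + v + (4 * m + 12))
  lemma = ℕSolver.solve-∀

even⊎odd : ∀ k → (∃ λ t → k ≡ t * 2) ⊎ (∃ λ t → k ≡ suc (t * 2))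
even⊎odd zero = inj₁ (0 , refl)
even⊎odd (suc k) with even⊎odd k
... | inj₁ (t , refl) = inj₂ (t , refl)
... | inj₂ (t , refl) = inj₁ (suc t , refl)

half< : ∀ t X → suc (t * 2) ≤ 2 * X → t < X
half< t X t≤ = *-cancelʳ-< 2 t X (subst (suc (t * 2) ≤_) (*-comm 2 X) t≤)

v3-stirling1-1 : ∀ m → v3 (stirling1 (2 * 3 ^ (2 + m)) 1) ≡ w (2 + m) 1 + (2 + m)
v3-stirling1-1 m = trans (v3-stirling1-odd (2 + m) 0 (m^n>0 3 (2 + m))) (cong (λ x → w (2 + m) 1 + x) (+-identityʳ (2 + m)))

v3-stirling1-≤ : ∀ m k → suc k ≤ 2 * 3 ^ (2 + m) → v3 (stirling1 (2 * 3 ^ (2 + m)) (suc k)) ≤ w (2 + m) 1 + (2 + m)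
v3-stirling1-≤ m k k≤ with even⊎odd k
... | inj₁ (t , refl) = subst (_≤ w (2 + m) 1 + (2 + m)) (sym (v3-stirling1-odd (2 + m) t t<))
    (lin≤ _ _ 0 (≤-trans (w-bound m t t<) (≤-reflexive (sym (w-1 (suc m)))))
      (lemma (w (2 + m) (suc t)) (v3 (suc (t * 2))) m (w (2 + m) 1)))
  where
  t< = half< t (3 ^ (2 + m)) k≤
  lemma : ∀ x v m y → x + ((2 + m) + v) + (y + (2 * (2 + m) + 1)) + 0 ≡ y + (2 + m) + (x + v + (2 * (2 + m) + 1))
  lemma = ℕSolver.solve-∀
... | inj₂ (t , refl) = subst (_≤ w (2 + m) 1 + (2 + m)) (sym (v3-stirling1-even (2 + m) t t<))
    (lin≤ _ _ (v3 (suc (t * 2)) + (2 + m)) (≤-trans (w-bound m t t<) (≤-reflexive (sym (w-1 (suc m)))))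
      (lemma (w (2 + m) (suc t)) (v3 (suc (t * 2))) m (w (2 + m) 1)))
  where
  t< = half< t (3 ^ (2 + m)) (≤-trans (n≤1+n _) k≤)
  lemma : ∀ x v m y → x + (y + (2 * (2 + m) + 1)) + (v + (2 + m)) ≡ y + (2 + m) + (x + v + (2 * (2 + m) + 1))
  lemma = ℕSolver.solve-∀

theorem1p5 : (n k : ℕ) → 1 ≤ n → 1 ≤ k → k ≤ 2 * 3 ^ n →
    (n ≥ 2 → v3 (stirling1 (2 * 3 ^ n) k) ≤ v3 (stirling1 (2 * 3 ^ n) 1)
    × v3 (stirling1 (2 * 3 ^ n) 1) ≡ 3 ^ n ∸ n ∸ 1)
    × (n ≡ 1 → v3 (stirling1 (2 * 3) k) ≤ v3 (stirling1 (2 * 3) 3)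
    × v3 (stirling1 (2 * 3) 3) ≡ 2)
theorem1p5 n k 1≤n 1≤k k≤ = large n k 1≤k k≤ , λ { refl →
    toWitness {a? = allUpTo? (λ k → v3 (stirling1 6 k) ≤? v3 (stirling1 6 3)) 7} _ (s≤s k≤) , refl }
  where
  large : ∀ n k → 1 ≤ k → k ≤ 2 * 3 ^ n → n ≥ 2 → v3 (stirling1 (2 * 3 ^ n) k) ≤ v3 (stirling1 (2 * 3 ^ n) 1)
    × v3 (stirling1 (2 * 3 ^ n) 1) ≡ 3 ^ n ∸ n ∸ 1
  large (suc zero) k 1≤k k≤ (s≤s ())
  large n@(suc (suc m)) (suc k) 1≤k k≤ n≥2 =
      subst (v3 (stirling1 (2 * 3 ^ n) (suc k)) ≤_) (sym (v3-stirling1-1 m)) (v3-stirling1-≤ m k k≤)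
    , (begin
      v3 (stirling1 (2 * 3 ^ n) 1)       ≡⟨ v3-stirling1-1 m ⟩
      w n 1 + n                          ≡⟨ m+n∸n≡m (w n 1 + n) (n + 1) ⟨
      w n 1 + n + (n + 1) ∸ (n + 1)      ≡⟨ cong (_∸ (n + 1)) (lemma (w n 1) n) ⟩
      w n 1 + (2 * n + 1) ∸ (n + 1)      ≡⟨ cong (_∸ (n + 1)) (w-1 (suc m)) ⟩
      3 ^ n ∸ (n + 1)                    ≡⟨ ∸-+-assoc (3 ^ n) n 1 ⟨
      3 ^ n ∸ n ∸ 1                      ∎)
    where
    open ≡-Reasoning
    lemma : ∀ x n → x + n + (n + 1) ≡ x + (2 * n + 1)
    lemma = ℕSolver.solve-∀
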